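{- Let $u$ be a positive integer with $u \equiv 1$ or $4 \pmod{12}$. Then there exists a Kirkman triple system of order $32u+1$ with chromatic number $4$, which furthermore admits an equitable $4$-colouring.
   Context: A Kirkman triple system KTS$(n)$ is a Steiner triple system on $n$ points together with a partition of its triples into parallel classes. A $\delta$-colouring maps points to $\delta$ colours with no monochromatic triple; the chromatic number is the least such $\delta$. A colouring is equitable if its colour class sizes differ pairwise by at most one. -}

module Defs where

open import Data.Nat using (ℕ; _≤_; _<_; _+_)
open import Data.Fin using (Fin)
open import Data.Fin.Properties using (_≟_)
open import Data.Bool using (Bool; _∨_; _∧_; not)
open import Data.List using (List; length; filterᵇ; concat; allFin)
open import Data.List.Relation.Unary.All using (All)
open import Data.List.Membership.Propositional using (_∈_)
open import Data.Product using (Σ; ∃; _×_)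
open import Relation.Nullary using (¬_)
open import Relation.Nullary.Decidable using (⌊_⌋)
open import Relation.Binary.PropositionalEquality using (_≡_; _≢_)

record Triple (n : ℕ) : Set where
  constructor triple
  field
    a b c : Fin n
    a≢b : a ≢ b
    a≢c : a ≢ c
    b≢c : b ≢ c
open Triple public

_∈ᵗ_ : {n : ℕ} → Fin n → Triple n → Bool
x ∈ᵗ t = ⌊ x ≟ a t ⌋ ∨ ⌊ x ≟ b t ⌋ ∨ ⌊ x ≟ c t ⌋

countPoint : {n : ℕ} → Fin n → List (Triple n) → ℕ
countPoint x B = length (filterᵇ (λ t → x ∈ᵗ t) B)

countPair : {n : ℕ} → Fin n → Fin n → List (Triple n) → ℕ
countPair x y B = length (filterᵇ (λ t → (x ∈ᵗ t) ∧ (y ∈ᵗ t)) B)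

IsSTS : (n : ℕ) → List (Triple n) → Set
IsSTS n B = ∀ (x y : Fin n) → x ≢ y → countPair x y B ≡ 1

IsParallelClass : (n : ℕ) → List (Triple n) → Set
IsParallelClass n C = ∀ (x : Fin n) → countPoint x C ≡ 1

record KTS (n : ℕ) : Set where
  field
    classes    : List (List (Triple n))
    parallel   : All (IsParallelClass n) classes
    steiner    : IsSTS n (concat classes)
open KTS public

triples : {n : ℕ} → KTS n → List (Triple n)
triples K = concat (classes K)

IsProperColouring : {n : ℕ} (K : KTS n) (δ : ℕ) → (Fin n → Fin δ) → Set
IsProperColouring K δ col =
  ∀ t → t ∈ triples K → ¬ ((col (a t) ≡ col (b t)) × (col (b t) ≡ col (c t)))

Colourable : {n : ℕ} → KTS n → ℕ → Set
Colourable {n} K δ = Σ (Fin n → Fin δ) (IsProperColouring K δ)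

HasChromaticNumber : {n : ℕ} → KTS n → ℕ → Set
HasChromaticNumber K δ = Colourable K δ × (∀ δ' → δ' < δ → ¬ Colourable K δ')

classSize : {n δ : ℕ} → (Fin n → Fin δ) → Fin δ → ℕ
classSize {n} col i = length (filterᵇ (λ x → ⌊ col x ≟ i ⌋) (allFin n))

IsEquitable : {n δ : ℕ} → (Fin n → Fin δ) → Set
IsEquitable {n} {δ} col = ∀ (i j : Fin δ) → classSize col i ≤ classSize col j + 1

{-# OPTIONS --safe #-}
module Submission where

-- Puncturing a KTS(2u + 1) at a point leaves a Kirkman frame with u holes of size 2. Inflate it by 16 and colour each new point
-- by a component of its inflation coordinate in F₄ × F₄; the transversal designs can be chosen so that no inflated block is
-- monochromatic. Filling every hole, together with one new point, with a KTS(33) whose equitable 4-colouring is the same on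
-- the hole gives the KTS(32u + 1). That KTS(33) is built from AG(2,4) by placing a copy of AG(2,3) over each line, and a
-- search shows that it has no proper 3-colouring.
--
-- Here u = 3r + 1 with r ≡ 0 or 1 (mod 4), and a KTS(2u + 1) comes from a frame with r holes of size 6, filled with copies of
-- AG(2,3). These frames are built recursively: truncating one group of a transversal design with five groups of size m to t
-- points is a pairwise balanced design on 4m + t points with blocks of sizes 4, 5, m and t.

open import Defs
open import Data.Nat using (ℕ; _+_; _*_; _%_; _>_)
open import Data.Sum using (_⊎_)
open import Data.Fin using (Fin)
open import Data.Product using (Σ; _×_)
open import Relation.Binary.PropositionalEquality using (_≡_)

open import Data.Bool using (Bool; true; false; _∧_; not; if_then_else_; T)
open import Data.Empty using (⊥; ⊥-elim)
open import Data.Fin using (zero; suc; toℕ; fromℕ<; inject≤; combine; remQuot; splitAt; join; _↑ˡ_; _↑ʳ_)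
open import Data.Fin.Properties using
  ( suc-injective; toℕ-fromℕ<; inject≤-injective; ↑ˡ-injective; ↑ʳ-injective
  ; splitAt-↑ˡ; splitAt-↑ʳ; splitAt⁻¹-↑ˡ; splitAt⁻¹-↑ʳ; splitAt-join; join-splitAt
  ; remQuot-combine; combine-remQuot) renaming (_≟_ to _≟ᶠ_)
open import Data.List using (List; []; _∷_; _++_; map; length; filterᵇ; concat; tabulate; allFin; applyUpTo)
open import Data.List.Membership.Propositional using (_∈_)
open import Data.List.Membership.Propositional.Properties using (∈-map⁺; ∈-map⁻; ∈-concat⁺′; ∈-concat⁻′; ∈-allFin)
open import Data.List.Relation.Unary.All using (All; []; _∷_)
import Data.List.Relation.Unary.All as All
import Data.List.Relation.Unary.All.Properties as All
open import Data.List.Relation.Unary.Any using (here; there)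
open import Data.Maybe using (Maybe; just; nothing)
import Data.Maybe as Maybe
open import Data.Maybe.Properties using (just-injective)
open import Data.Nat using
  (zero; suc; _∸_; _/_; _⊓_; _≤_; _<_; _≤ᵇ_; _≡ᵇ_; _<?_; z≤n; s≤s; NonZero; >-nonZero)
open import Data.Nat.DivMod using (_mod_; m≡m%n+[m/n]*n; m/n<m; m%n<n; [m+kn]%n≡m%n; /-monoˡ-≤; m*n%n≡0)
open import Data.Nat.Induction using (<-rec)
open import Data.Nat.Properties using
  ( ≡ᵇ⇒≡; ≤ᵇ⇒≤; ≤-trans; ≤-reflexive; ≤-pred; <-≤-trans; ≮⇒≥; +-comm; +-assoc; +-identityʳ; *-comm; *-distribʳ-+
  ; +-monoˡ-≤; +-monoʳ-≤; *-monoʳ-≤; ∸-monoˡ-<; m+[n∸m]≡n; m≤m+n; m≤n+m; m<n+m; module ≤-Reasoning)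
open import Data.Nat.Tactic.RingSolver using (solve-∀)
open import Data.Product using (∃-syntax; _,_; proj₁; proj₂; map₁; uncurry)
open import Data.Product.Properties.WithK using (,-injectiveʳ)
open import Data.Sum using (inj₁; inj₂; [_,_]′)
import Data.Sum as Sum
open import Data.Sum.Properties using (inj₂-injective)
open import Data.Unit using (⊤; tt)
open import Data.Vec using (Vec; []; _∷_; lookup; replicate; _[_]≔_; toList)
open import Data.Vec.Properties using (lookup∘update; lookup∘update′; lookup-replicate)
open import Function using (_∘_; id)
open import Level using (Level)
open import Relation.Binary using (DecidableEquality)
open import Relation.Binary.PropositionalEquality using (_≢_; refl; sym; trans; cong; cong₂; subst; subst₂)
open import Relation.Nullary using (¬_; yes; no)
open import Relation.Nullary.Decidable using (⌊_⌋)

-- Resolvability is turned into incidence. Each parallel class becomes one more object, and a triple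
-- together with its class becomes a block of size 4. A KTS is then an exact decomposition into
-- blocks of the graph on classes and points in which only pairs of classes are not joined; in a
-- Kirkman frame the pairs inside a hole are left out as well. A hole of size 2 is missed by exactly
-- one partial class, so it is modelled as one class and two points. Operations on hole indices act
-- on all three objects alike, and the recursive constructions need no separate argument about
-- parallel classes; inflation only asks for transversal designs with four groups, one for the class
-- and three for the points of a triple.
--
-- The residue of r survives the recursion: with r = 4 (m + d) + e one takes t = 4 d + e, so that r
-- = 4 m + t and t has the residue e again. What remains is to choose m close enough to r / 4 for t
-- to be at most m. For the chromatic number a single hole suffices from below, since its KTS(33) is
-- a subsystem to which every colouring restricts.

-- Exact decompositions of relations

Rel : Set → Set₁
Rel A = A → A → Set

Any : {A : Set} → Rel A
Any _ _ = ⊤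

_⊗_ : {A B : Set} → Rel A → Rel B → Rel (A × B)
(R ⊗ S) x y = R (proj₁ x) (proj₁ y) × S (proj₂ x) (proj₂ y)

-- The relation is a directed graph, cut into copies of the graphs `R l`. `unique` returns the two
-- preimages along with the index because `compose` has to hand them to the uniqueness of the inner
-- decomposition.
record Cover {L : Set} {I : L → Set} (R : ∀ l → Rel (I l))
             {O : Set} (_~_ : Rel O) (e : ∀ l → I l → O) : Set where
  field
    hom    : ∀ {l p q} → R l p q → e l p ~ e l q
    cover  : ∀ {x y} → x ~ y → ∃[ l ] ∃[ p ] ∃[ q ] R l p q × e l p ≡ x × e l q ≡ y
    unique : ∀ {l p q l′ p′ q′} → R l p q → R l′ p′ q′ → e l p ≡ e l′ p′ → e l q ≡ e l′ q′ →
             _≡_ {A = Σ L (λ l → I l × I l)} (l , p , q) (l′ , p′ , q′)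

module _ {L : Set} {I : L → Set} {R : ∀ l → Rel (I l)} {O : Set} {_~_ : Rel O} {e : ∀ l → I l → O} where

  compose : {M : L → Set} {J : ∀ l → M l → Set} {S : ∀ l m → Rel (J l m)} {d : ∀ l m → J l m → I l} →
            Cover R _~_ e → (∀ l → Cover (S l) (R l) (d l)) →
            Cover {Σ L M} (λ (l , m) → S l m) _~_ (λ (l , m) p → e l (d l m p))
  compose {M} {J} {S} {d} outer inner = record
    { hom    = λ {(l , m)} s → Cover.hom outer (Cover.hom (inner l) s)
    ; cover  = λ x~y →
        let (l , p , q , r , ep , eq) = Cover.cover outer x~y
            (m , p′ , q′ , s , dp , dq) = Cover.cover (inner l) r
        in (l , m) , p′ , q′ , s , trans (cong (e l) dp) ep , trans (cong (e l) dq) eq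
    ; unique = λ {(l , m)} {p} {q} {(l′ , m′)} {p′} {q′} s s′ ep eq →
        glue s s′ (Cover.unique outer (Cover.hom (inner l) s) (Cover.hom (inner l′) s′) ep eq)
    }
    where
    glue : ∀ {l m p q l′ m′ p′ q′} → S l m p q → S l′ m′ p′ q′ →
           _≡_ {A = Σ L (λ l → I l × I l)} (l , d l m p , d l m q) (l′ , d l′ m′ p′ , d l′ m′ q′) →
           _≡_ {A = Σ (Σ L M) (λ (l , m) → J l m × J l m)} ((l , m) , p , q) ((l′ , m′) , p′ , q′)
    glue {l} {m} {p} {q} {l′} {m′} {p′} {q′} s s′ eq with cong proj₁ eq
    ... | refl = cong (λ (m , p , q) → (l , m) , p , q)
                   (Cover.unique (inner l) s s′ (cong proj₁ (,-injectiveʳ eq)) (cong proj₂ (,-injectiveʳ eq)))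

  lift : {A : Set} (T : Rel A) → Cover R _~_ e → Cover (λ l → R l ⊗ T) (_~_ ⊗ T) (λ l → map₁ (e l))
  lift T c = record
    { hom    = λ (r , t) → Cover.hom c r , t
    ; cover  = λ {(x , a)} {(y , b)} (x~y , t) →
        let (l , p , q , r , ep , eq) = Cover.cover c x~y
        in l , (p , a) , (q , b) , (r , t) , cong (_, a) ep , cong (_, b) eq
    ; unique = λ {l} {(p , a)} {(q , b)} {l′} {(p′ , a′)} {(q′ , b′)} (r , _) (r′ , _) ep eq →
        glue (Cover.unique c r r′ (cong proj₁ ep) (cong proj₁ eq)) (cong proj₂ ep) (cong proj₂ eq)
    }
    where
    glue : ∀ {l p q l′ p′ q′ a b a′ b′} →
           _≡_ {A = Σ L (λ l → I l × I l)} (l , p , q) (l′ , p′ , q′) → a ≡ a′ → b ≡ b′ →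
           _≡_ {A = Σ L (λ l → (I l × _) × (I l × _))} (l , (p , a) , (q , b)) (l′ , (p′ , a′) , (q′ , b′))
    glue refl refl refl = refl

iso : {A B : Set} {R : Rel A} {S : Rel B} (f : A → B) (g : B → A) →
      (∀ x → g (f x) ≡ x) → (∀ y → f (g y) ≡ y) →
      (∀ {x y} → R x y → S (f x) (f y)) → (∀ {x y} → S (f x) (f y) → R x y) →
      Cover {⊤} (λ _ → R) S (λ _ → f)
iso {S = S} f g gf fg to from = record
  { hom    = to
  ; cover  = λ {x} {y} s → tt , g x , g y , from (subst₂ S (sym (fg x)) (sym (fg y)) s) , fg x , fg y
  ; unique = λ _ _ ep eq → cong₂ (λ p q → tt , p , q) (inj ep) (inj eq)
  }
  where
  inj : ∀ {x y} → f x ≡ f y → x ≡ y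
  inj {x} {y} eq = trans (sym (gf x)) (trans (cong g eq) (gf y))

-- Resolved designs and Kirkman frames

isZero : ∀ {n} → Fin n → Bool
isZero zero    = true
isZero (suc _) = false

-- Objects are classes and points; a block is a parallel class followed by the three points of one of its triples.
record Resolved {O : Set} (isClass : O → Bool) (_~_ : Rel O) : Set₁ where
  field
    Block  : Set
    obj    : Block → Fin 4 → O
    covers : Cover (λ _ → _≢_) _~_ obj
    kind   : ∀ β i → isClass (obj β i) ≡ isZero i
open Resolved public

resolve : {O L : Set} {I : L → Set} {R : ∀ l → Rel (I l)} {_~_ : Rel O} {e : ∀ l → I l → O}
          {isC : O → Bool} {isC′ : ∀ l → I l → Bool} →
          Cover R _~_ e → (∀ l p → isC (e l p) ≡ isC′ l p) → (∀ l → Resolved (isC′ l) (R l)) →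
          Resolved isC _~_
resolve {L = L} {e = e} c k F = record
  { Block  = Σ L (λ l → Block (F l))
  ; obj    = λ (l , β) i → e l (obj (F l) β i)
  ; covers = compose c (λ l → covers (F l))
  ; kind   = λ (l , β) i → trans (k l _) (kind (F l) β i)
  }

_∥_ : Rel (Fin 3)
a ∥ b = ¬ (isZero a ≡ true × isZero b ≡ true)

-- (c , zero) is a parallel class, (c , suc b) are the two points of the hole c.
Frame : {C : Set} → Rel C → Set₁
Frame {C} _#_ = Resolved {C × Fin 3} (isZero ∘ proj₂) (_#_ ⊗ _∥_)

-- Wilson's fundamental construction. Each index is given the weight of one class and two points, so
-- every piece of the decomposition turns into the pairs that a frame on its indices covers.
decompose : {C L : Set} {I : L → Set} {R : ∀ l → Rel (I l)} {_#_ : Rel C} {e : ∀ l → I l → C} →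
            Cover R _#_ e → (∀ l → Frame (R l)) → Frame _#_
decompose c = resolve (lift _∥_ c) (λ _ _ → refl)

-- Kirkman frames with holes of size 2 w indexed by V.
Uniform : ℕ → Set → Set₁
Uniform w V = Frame {V × Fin w} (_≢_ ⊗ Any)

pbd : {w : ℕ} {V L : Set} {I : L → Set} {e : ∀ l → I l → V} →
      Cover (λ _ → _≢_) _≢_ e → (∀ l → Uniform w (I l)) → Uniform w V
pbd c = decompose (lift Any c)

-- Transversal designs, inflation and direct products

-- A transversal design with k + 1 groups of size m; block (a , b) meets the last group in b.
record TD (k m : ℕ) : Set where
  field
    f     : Fin k → Fin m → Fin m → Fin m
    meet₂ : ∀ {i j} → i ≢ j → ∀ y z → ∃[ a ] ∃[ b ] f i a b ≡ y × f j a b ≡ z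
    uniq₂ : ∀ {i j} → i ≢ j → ∀ {a b a′ b′} → f i a b ≡ f i a′ b′ → f j a b ≡ f j a′ b′ → (a , b) ≡ (a′ , b′)
    meet₁ : ∀ i y b → ∃[ a ] f i a b ≡ y
    uniq₁ : ∀ i {a a′} b → f i a b ≡ f i a′ b → a ≡ a′

module _ {k m : ℕ} (D : TD k m) where
  open TD D

  tdBlock : Fin m × Fin m → Fin (suc k) → Fin (suc k) × Fin m
  tdBlock (a , b) zero    = zero , b
  tdBlock (a , b) (suc i) = suc i , f i a b

  private
    index : ∀ l l′ p p′ → tdBlock l p ≡ tdBlock l′ p′ → p ≡ p′
    index _ _ zero    zero     _  = refl
    index _ _ zero    (suc _)  ()
    index _ _ (suc _) zero     ()
    index _ _ (suc _) (suc _)  eq = cong proj₁ eq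

    uniq : ∀ l l′ p q → p ≢ q → tdBlock l p ≡ tdBlock l′ p → tdBlock l q ≡ tdBlock l′ q → l ≡ l′
    uniq _ _ zero    zero    p≢q _  _  = ⊥-elim (p≢q refl)
    uniq (a , b) (a′ , b′) zero    (suc j) _ ep eq with refl ← cong proj₂ ep = cong (_, b) (uniq₁ j b (cong proj₂ eq))
    uniq (a , b) (a′ , b′) (suc i) zero    _ ep eq with refl ← cong proj₂ eq = cong (_, b) (uniq₁ i b (cong proj₂ ep))
    uniq _ _ (suc i) (suc j) p≢q ep eq = uniq₂ (p≢q ∘ cong suc) (cong proj₂ ep) (cong proj₂ eq)

    meet : ∀ x y → proj₁ x ≢ proj₁ y →
           ∃[ l ] ∃[ p ] ∃[ q ] p ≢ q × tdBlock l p ≡ x × tdBlock l q ≡ y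
    meet (zero , b) (zero , _)  p≢q = ⊥-elim (p≢q refl)
    meet (zero , b) (suc j , z) p≢q =
      let (a , eq) = meet₁ j z b in (a , b) , zero , suc j , p≢q , refl , cong (suc j ,_) eq
    meet (suc i , y) (zero , b) p≢q =
      let (a , eq) = meet₁ i y b in (a , b) , suc i , zero , p≢q , cong (suc i ,_) eq , refl
    meet (suc i , y) (suc j , z) p≢q =
      let (a , b , ep , eq) = meet₂ (p≢q ∘ cong suc) y z
      in (a , b) , suc i , suc j , p≢q , cong (suc i ,_) ep , cong (suc j ,_) eq

  tdCover : Cover (λ _ → _≢_) (_≢_ ⊗ Any) tdBlock
  tdCover = record
    { hom    = λ { {_} {zero} {zero} n → n , tt ; {_} {zero} {suc _} n → n , tt
                 ; {_} {suc _} {zero} n → n , tt ; {_} {suc _} {suc _} n → n , tt }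
    ; cover  = λ (n , _) → meet _ _ n
    ; unique = unique
    }
    where
    unique : ∀ {l p q l′ p′ q′} → p ≢ q → p′ ≢ q′ → tdBlock l p ≡ tdBlock l′ p′ → tdBlock l q ≡ tdBlock l′ q′ →
             _≡_ {A = _ × _ × _} (l , p , q) (l′ , p′ , q′)
    unique {l} {p} {q} {l′} {p′} {q′} n _ ep eq with index l l′ p p′ ep | index l l′ q q′ eq
    ... | refl | refl = cong (_, p , q) (uniq l l′ p q n ep eq)

-- Each object of a block is replaced by `w` copies, and the transversal design covers the pairs
-- between the four resulting groups. Group `zero` belongs to the class, so point `i` of the new
-- triple receives the coordinate `f i a b`; the colouring depends on this.
inflate : {C : Set} {_#_ : Rel C} {w : ℕ} → TD 3 w → Frame _#_ → Frame {C × Fin w} (_#_ ⊗ Any)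
inflate {C} {_#_} {w} D F = record
  { Block  = ⊤ × Block F × (Fin w × Fin w)
  ; obj    = λ (_ , β , l) i → swap (map₁ (obj F β) (tdBlock D l i))
  ; covers = compose (iso {R = (_#_ ⊗ _∥_) ⊗ Any} swap (λ ((c , a) , b) → (c , b) , a)
                        (λ _ → refl) (λ _ → refl)
                        (λ ((r , s) , _) → (r , tt) , s) (λ ((r , _) , s) → (r , s) , tt))
               (λ _ → compose (lift Any (covers F)) (λ _ → tdCover D))
  ; kind   = λ { (_ , β , l) zero → kind F β zero ; (_ , β , l) (suc i) → kind F β (suc i) }
  }
  where
  swap : (C × Fin 3) × Fin w → (C × Fin w) × Fin 3
  swap ((c , b) , a) = (c , a) , b

-- MacNeish's direct product. The second component of a value is computed from second components
-- only, so a colouring by that component sees nothing but `E`.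
productTD : ∀ {k m n} → TD k m → TD k n → TD k (m * n)
productTD {k} {m} {n} D E = record
  { f     = λ i x y → combine (D.f i (q x) (q y)) (E.f i (r x) (r y))
  ; meet₂ = λ i≢j y z →
      let (a , b , e₁ , e₂)   = D.meet₂ i≢j (q y) (q z)
          (a′ , b′ , e₃ , e₄) = E.meet₂ i≢j (r y) (r z)
      in combine a a′ , combine b b′ , build e₁ e₃ , build e₂ e₄
  ; uniq₂ = λ i≢j ey ez →
      let (e₁ , e₂) = split ey
          (e₃ , e₄) = split ez
          h  = D.uniq₂ i≢j e₁ e₃
          h′ = E.uniq₂ i≢j e₂ e₄
      in cong₂ _,_ (pair (cong proj₁ h) (cong proj₁ h′)) (pair (cong proj₂ h) (cong proj₂ h′))
  ; meet₁ = λ i y b →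
      let (a , e₁)  = D.meet₁ i (q y) (q b)
          (a′ , e₂) = E.meet₁ i (r y) (r b)
      in combine a a′ , trans (cong₂ (λ u v → combine (D.f i u (q b)) (E.f i v (r b))) (q-c a a′) (r-c a a′))
                              (trans (cong₂ combine e₁ e₂) (combine-remQuot {m} n y))
  ; uniq₁ = λ i b e → let (e₁ , e₂) = split e in pair (D.uniq₁ i (q b) e₁) (E.uniq₁ i (r b) e₂)
  }
  where
  module D = TD D
  module E = TD E
  q : Fin (m * n) → Fin m
  q = proj₁ ∘ remQuot {m} n
  r : Fin (m * n) → Fin n
  r = proj₂ ∘ remQuot {m} n
  q-c : ∀ a b → q (combine a b) ≡ a
  q-c a b = cong proj₁ (remQuot-combine {m} a b)
  r-c : ∀ a b → r (combine a b) ≡ b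
  r-c a b = cong proj₂ (remQuot-combine {m} a b)
  split : ∀ {a b a′ b′} → combine {m} {n} a b ≡ combine a′ b′ → a ≡ a′ × b ≡ b′
  split {a} {b} {a′} {b′} e = trans (sym (q-c a b)) (trans (cong q e) (q-c a′ b′))
                            , trans (sym (r-c a b)) (trans (cong r e) (r-c a′ b′))
  pair : ∀ {x y} → q x ≡ q y → r x ≡ r y → x ≡ y
  pair {x} {y} e e′ = trans (sym (combine-remQuot {m} n x)) (trans (cong₂ combine e e′) (combine-remQuot {m} n y))
  build : ∀ {i a b a′ b′ y} → D.f i a b ≡ q y → E.f i a′ b′ ≡ r y →
          combine (D.f i (q (combine a a′)) (q (combine b b′))) (E.f i (r (combine a a′)) (r (combine b b′))) ≡ y
  build {i} {a} {b} {a′} {b′} {y} e e′ =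
    trans (cong₂ combine (trans (cong₂ (D.f i) (q-c a a′) (q-c b b′)) e)
                         (trans (cong₂ (E.f i) (r-c a a′) (r-c b b′)) e′))
          (combine-remQuot {m} n y)

-- Adjoining an element and filling holes

module _ {V : Set} (_≟ᵛ_ : DecidableEquality V) {k : ℕ} (E : Rel (Fin (suc k))) where

  code : Maybe (V × Fin k) → Fin (suc k)
  code nothing        = zero
  code (just (_ , c)) = suc c

  Hole : Maybe V → Set
  Hole nothing  = V × Fin k
  Hole (just _) = Fin (suc k)

  embed : ∀ l → Hole l → Maybe (V × Fin k)
  embed nothing  x       = just x
  embed (just _) zero    = nothing
  embed (just v) (suc c) = just (v , c)

  HoleRel : ∀ l → Rel (Hole l)
  HoleRel nothing  (v , c) (v′ , c′) = v ≢ v′ × E (suc c) (suc c′)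
  HoleRel (just _) p q = p ≢ q × E p q

  -- Pairs from different groups go to the part `nothing`. Any other pair of distinct elements
  -- involves exactly one group, since the adjoined element occurs in it at most once, and goes to
  -- the filling of that group. `E` exempts pairs of classes when objects are filled in, and is
  -- trivial when hole indices are.
  fill : Cover HoleRel (λ x y → x ≢ y × E (code x) (code y)) embed
  fill = record { hom = λ {l} → hom l ; cover = λ {x} {y} (n , r) → cover x y n r ; unique = λ {l} {_} {_} {l′} → unique l l′ _ _ _ _ }
    where
    hom : ∀ l {p q} → HoleRel l p q → embed l p ≢ embed l q × E (code (embed l p)) (code (embed l q))
    hom nothing (v≢ , r) = (v≢ ∘ cong proj₁ ∘ just-injective) , r
    hom (just v) {zero}  {zero}  (n , r) = ⊥-elim (n refl)
    hom (just v) {zero}  {suc _} (n , r) = (λ ()) , r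
    hom (just v) {suc _} {zero}  (n , r) = (λ ()) , r
    hom (just v) {suc _} {suc _} (n , r) = (n ∘ cong suc ∘ cong proj₂ ∘ just-injective) , r

    cover : ∀ x y → x ≢ y → E (code x) (code y) →
            ∃[ l ] ∃[ p ] ∃[ q ] HoleRel l p q × embed l p ≡ x × embed l q ≡ y
    cover nothing        nothing          n r = ⊥-elim (n refl)
    cover nothing        (just (v , c))   n r = just v , zero , suc c , ((λ ()) , r) , refl , refl
    cover (just (v , c)) nothing          n r = just v , suc c , zero , ((λ ()) , r) , refl , refl
    cover (just (v , c)) (just (v′ , c′)) n r with v ≟ᵛ v′
    ... | no v≢v′  = nothing , (v , c) , (v′ , c′) , (v≢v′ , r) , refl , refl
    ... | yes refl = just v , suc c , suc c′ , (n ∘ cong (λ c → just (v , c)) ∘ suc-injective , r) , refl , refl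

    unique : ∀ l l′ p q p′ q′ → HoleRel l p q → HoleRel l′ p′ q′ → embed l p ≡ embed l′ p′ → embed l q ≡ embed l′ q′ →
             _≡_ {A = Σ (Maybe V) (λ l → Hole l × Hole l)} (l , p , q) (l′ , p′ , q′)
    unique nothing nothing p q p′ q′ _ _ refl refl = refl
    unique nothing (just _) p q (suc _) (suc _) (n , _) _ refl refl = ⊥-elim (n refl)
    unique (just _) nothing (suc _) (suc _) p′ q′ _ (n , _) refl refl = ⊥-elim (n refl)
    unique (just _) (just _) zero zero _ _ (n , _) _ _ _ = ⊥-elim (n refl)
    unique (just _) (just _) zero (suc _) zero (suc _) _ _ _ refl = refl
    unique (just _) (just _) (suc _) zero (suc _) zero _ _ refl _ = refl
    unique (just _) (just _) (suc _) (suc _) (suc _) (suc _) _ _ refl refl = refl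

-- Truncated transversal designs as pairwise balanced designs

module _ {t s : ℕ} (D : TD 4 (t + s)) where
  open TD D

  Pt : Set
  Pt = (Fin 4 × Fin (t + s)) ⊎ Fin t

  -- The group indexed by the second block parameter is the one truncated: `long` blocks pass
  -- through a point that is kept, `short` ones have lost theirs.
  data Line : Set where
    group : Fin 4 → Line
    top   : Line
    long  : Fin (t + s) → Fin t → Line
    short : Fin (t + s) → Fin s → Line

  On : Line → Set
  On (group _)   = Fin (t + s)
  On top         = Fin t
  On (long _ _)  = Fin 5
  On (short _ _) = Fin 4

  on : ∀ l → On l → Pt
  on (group i)   y       = inj₁ (i , y)
  on top         y       = inj₂ y
  on (long a b)  zero    = inj₂ b
  on (long a b)  (suc i) = inj₁ (i , f i a (b ↑ˡ s))
  on (short a b) i       = inj₁ (i , f i a (t ↑ʳ b))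

  private
    Result : Pt → Pt → Set
    Result x y = ∃[ l ] ∃[ p ] ∃[ q ] p ≢ q × on l p ≡ x × on l q ≡ y

    through : ∀ {i j} → i ≢ j → ∀ a b {y z} → f i a b ≡ y → f j a b ≡ z → Result (inj₁ (i , y)) (inj₁ (j , z))
    through i≢j a b ey ez with splitAt t b | join-splitAt t s b
    ... | inj₁ b′ | refl = long a b′ , suc _ , suc _ , i≢j ∘ suc-injective , cong (inj₁ ∘ (_ ,_)) ey , cong (inj₁ ∘ (_ ,_)) ez
    ... | inj₂ b′ | refl = short a b′ , _ , _ , i≢j , cong (inj₁ ∘ (_ ,_)) ey , cong (inj₁ ∘ (_ ,_)) ez

    cover : ∀ x y → x ≢ y → Result x y
    cover (inj₁ (i , y)) (inj₁ (j , z)) n with i ≟ᶠ j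
    ... | yes refl = group i , y , z , n ∘ cong (inj₁ ∘ (i ,_)) , refl , refl
    ... | no i≢j   = let (a , b , ey , ez) = meet₂ i≢j y z in through i≢j a b ey ez
    cover (inj₁ (i , y)) (inj₂ b) n = let (a , e) = meet₁ i y (b ↑ˡ s) in
      long a b , suc i , zero , (λ ()) , cong (inj₁ ∘ (i ,_)) e , refl
    cover (inj₂ b) (inj₁ (j , z)) n = let (a , e) = meet₁ j z (b ↑ˡ s) in
      long a b , zero , suc j , (λ ()) , refl , cong (inj₁ ∘ (j ,_)) e
    cover (inj₂ y) (inj₂ z) n = top , y , z , n ∘ cong inj₂ , refl , refl

    fst-eq : ∀ {i j : Fin 4} {y z : Fin (t + s)} → _≡_ {A = Pt} (inj₁ (i , y)) (inj₁ (j , z)) → i ≡ j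
    fst-eq refl = refl
    snd-eq : ∀ {i j : Fin 4} {y z : Fin (t + s)} → _≡_ {A = Pt} (inj₁ (i , y)) (inj₁ (j , z)) → y ≡ z
    snd-eq refl = refl

    long≢short : ∀ {b : Fin t} {b′ : Fin s} → b ↑ˡ s ≢ t ↑ʳ b′
    long≢short {b} {b′} eq with trans (sym (splitAt-join t s (inj₁ b))) (trans (cong (splitAt t) eq) (splitAt-join t s (inj₂ b′)))
    ... | ()

    Goal : ∀ l (p q : On l) l′ (p′ q′ : On l′) → Set
    Goal l p q l′ p′ q′ = _≡_ {A = Σ Line (λ l → On l × On l)} (l , p , q) (l′ , p′ , q′)

    meet : ∀ {i j} → i ≢ j → ∀ {a b a′ b′} {i′ j′} →
           _≡_ {A = Pt} (inj₁ (i , f i a b)) (inj₁ (i′ , f i′ a′ b′)) →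
           _≡_ {A = Pt} (inj₁ (j , f j a b)) (inj₁ (j′ , f j′ a′ b′)) → (a , b) ≡ (a′ , b′)
    meet n ep eq with fst-eq ep | fst-eq eq
    ... | refl | refl = uniq₂ n (snd-eq ep) (snd-eq eq)

    meet′ : ∀ {i j a a′ b} → _≡_ {A = Pt} (inj₁ (i , f i a b)) (inj₁ (j , f j a′ b)) → (i , a) ≡ (j , a′)
    meet′ e with fst-eq e
    ... | refl = cong (_ ,_) (uniq₁ _ _ (snd-eq e))

    unique : ∀ l l′ p q p′ q′ → p ≢ q → p′ ≢ q′ → on l p ≡ on l′ p′ → on l q ≡ on l′ q′ → Goal l p q l′ p′ q′
    unique (group i) (group j) _ _ _ _ _ _ refl refl = refl
    unique (group i) (long _ _) _ _ (suc _) (suc _) n n′ ep eq = ⊥-elim (n′ (cong suc (trans (sym (fst-eq ep)) (fst-eq eq))))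
    unique (group i) (short _ _) _ _ _ _ n n′ ep eq = ⊥-elim (n′ (trans (sym (fst-eq ep)) (fst-eq eq)))
    unique top top _ _ _ _ _ _ refl refl = refl
    unique top (long _ _) _ _ zero zero n n′ ep eq = ⊥-elim (n′ refl)
    unique (long _ _) (group i) (suc _) (suc _) _ _ n n′ ep eq = ⊥-elim (n (cong suc (trans (fst-eq ep) (sym (fst-eq eq)))))
    unique (long _ _) top zero zero _ _ n _ _ _ = ⊥-elim (n refl)
    unique (long a b) (long a′ b′) zero zero _ _ n _ _ _ = ⊥-elim (n refl)
    unique (long a b) (long a′ b′) zero (suc j) zero (suc j′) n n′ refl eq with meet′ eq
    ... | refl = refl
    unique (long a b) (long a′ b′) (suc i) zero (suc i′) zero n n′ ep refl with meet′ ep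
    ... | refl = refl
    unique (long a b) (long a′ b′) (suc i) (suc j) (suc i′) (suc j′) n n′ ep eq with fst-eq ep | fst-eq eq | meet (n ∘ cong suc) ep eq
    ... | refl | refl | e with cong proj₁ e | ↑ˡ-injective s _ _ (cong proj₂ e)
    ... | refl | refl = refl
    unique (long a b) (short a′ b′) (suc i) (suc j) i′ j′ n n′ ep eq = ⊥-elim (long≢short (cong proj₂ (meet (n ∘ cong suc) ep eq)))
    unique (short _ _) (group i) _ _ _ _ n n′ ep eq = ⊥-elim (n (trans (fst-eq ep) (sym (fst-eq eq))))
    unique (short a b) (long a′ b′) i j (suc i′) (suc j′) n n′ ep eq = ⊥-elim (long≢short (sym (cong proj₂ (meet n ep eq))))
    unique (short a b) (short a′ b′) i j i′ j′ n n′ ep eq with fst-eq ep | fst-eq eq | meet n ep eq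
    ... | refl | refl | e with cong proj₁ e | ↑ʳ-injective t _ _ (cong proj₂ e)
    ... | refl | refl = refl

    hom : ∀ l p q → p ≢ q → on l p ≢ on l q
    hom (group i) p q n = n ∘ snd-eq
    hom top p q n = n ∘ inj₂-injective
    hom (long a b) zero zero n = ⊥-elim (n refl)
    hom (long a b) zero (suc q) n = λ ()
    hom (long a b) (suc p) zero n = λ ()
    hom (long a b) (suc p) (suc q) n = n ∘ cong suc ∘ fst-eq
    hom (short a b) p q n = n ∘ fst-eq

  truncated : Cover (λ _ → _≢_) _≢_ on
  truncated = record { hom = hom _ _ _ ; cover = cover _ _ ; unique = unique _ _ _ _ _ _ }

  flatten : Pt → Fin (4 * (t + s) + t)
  flatten = join (4 * (t + s)) t ∘ Sum.map₁ (uncurry combine)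

  unflatten : Fin (4 * (t + s) + t) → Pt
  unflatten = Sum.map₁ (remQuot (t + s)) ∘ splitAt (4 * (t + s))

  step : ∀ {w} → Uniform w (Fin 4) → Uniform w (Fin 5) → Uniform w (Fin (t + s)) → Uniform w (Fin t) →
         Uniform w (Fin (4 * (t + s) + t))
  step F₄ F₅ Fₘ Fₜ = pbd (iso flatten unflatten un∘num num∘un
                            (λ n e → n (trans (sym (un∘num _)) (trans (cong unflatten e) (un∘num _))))
                            (λ n e → n (cong flatten e)))
                         (λ _ → pbd truncated parts)
    where
    parts : ∀ l → Uniform _ (On l)
    parts (group _)   = Fₘ
    parts top         = Fₜ
    parts (long _ _)  = F₅
    parts (short _ _) = F₄
    un∘num : ∀ x → unflatten (flatten x) ≡ x
    un∘num (inj₁ (i , y)) rewrite splitAt-join (4 * (t + s)) t (inj₁ (combine i y)) = cong inj₁ (remQuot-combine i y)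
    un∘num (inj₂ y) rewrite splitAt-join (4 * (t + s)) t (inj₂ y) = refl
    num∘un : ∀ x → flatten (unflatten x) ≡ x
    num∘un x with splitAt (4 * (t + s)) x | join-splitAt (4 * (t + s)) t x
    ... | inj₁ y | e = trans (cong (_↑ˡ t) (combine-remQuot {4} (t + s) y)) e
    ... | inj₂ y | e = e

-- Verification of finite designs by computation

∧-true : ∀ {a b} → a ∧ b ≡ true → a ≡ true × b ≡ true
∧-true {true} {true} _ = refl , refl

∧-intro : ∀ {a b} → a ≡ true → b ≡ true → a ∧ b ≡ true
∧-intro refl refl = refl

not-true : ∀ {a} → a ≢ true → not a ≡ true
not-true {true}  n = ⊥-elim (n refl)
not-true {false} n = refl

not-elim : ∀ {a} → not a ≡ true → a ≢ true
not-elim {false} _ ()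

_⇒_ : Bool → Bool → Bool
true  ⇒ b = b
false ⇒ _ = true

⇒-elim : ∀ {a b} → a ⇒ b ≡ true → a ≡ true → b ≡ true
⇒-elim h refl = h

_==_ : ∀ {n} → Fin n → Fin n → Bool
zero  == zero  = true
zero  == suc _ = false
suc _ == zero  = false
suc i == suc j = i == j

==-sound : ∀ {n} {i j : Fin n} → i == j ≡ true → i ≡ j
==-sound {i = zero}  {zero}  _ = refl
==-sound {i = suc i} {suc j} h = cong suc (==-sound h)

==-refl : ∀ {n} (i : Fin n) → i == i ≡ true
==-refl zero    = refl
==-refl (suc i) = ==-refl i

≢-intro : ∀ {n} {i j : Fin n} → not (i == j) ≡ true → i ≢ j
≢-intro {i = i} h refl = not-elim h (==-refl i)

≢-elim : ∀ {n} {i j : Fin n} → i ≢ j → not (i == j) ≡ true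
≢-elim n = not-true (n ∘ ==-sound)

allF : ∀ {n} → (Fin n → Bool) → Bool
allF {zero}  _ = true
allF {suc n} f = f zero ∧ allF (f ∘ suc)

allF-sound : ∀ {n} {f : Fin n → Bool} → allF f ≡ true → ∀ i → f i ≡ true
allF-sound h zero    = proj₁ (∧-true h)
allF-sound {f = f} h (suc i) = allF-sound (proj₂ (∧-true {f zero} h)) i

position : ∀ {k} → ℕ → Vec ℕ k → Maybe (Fin k)
position x []       = nothing
position x (y ∷ ys) = if x ≡ᵇ y then just zero else Maybe.map suc (position x ys)

find : ∀ {b k} → Vec (Vec ℕ k) b → ℕ → ℕ → Maybe (Fin b × Fin k × Fin k)
find []       x y = nothing
find (v ∷ vs) x y with position x v | position y v
... | just i  | just j  = just (zero , i , j)
... | just _  | nothing = Maybe.map (map₁ suc) (find vs x y)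
... | nothing | _       = Maybe.map (map₁ suc) (find vs x y)

_⇔ᵇ_ : Bool → Bool → Bool
true  ⇔ᵇ b = b
false ⇔ᵇ b = not b

⇔ᵇ-sound : ∀ a b → a ⇔ᵇ b ≡ true → a ≡ b
⇔ᵇ-sound true  true  _ = refl
⇔ᵇ-sound false false _ = refl

module Finite (n : ℕ) {{_ : NonZero n}} (rel : Fin n → Fin n → Bool) {b : ℕ} (blocks : Vec (Vec ℕ 4) b) where

  fobj : Fin b → Fin 4 → Fin n
  fobj β i = lookup (lookup blocks β) i mod n

  joins : Fin n → Fin n → Maybe (Fin b × Fin 4 × Fin 4) → Bool
  joins x y nothing            = false
  joins x y (just (β , i , j)) = not (i == j) ∧ (fobj β i == x ∧ fobj β j == y)

  locates : Fin b → Fin 4 → Fin 4 → Maybe (Fin b × Fin 4 × Fin 4) → Bool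
  locates β i j nothing               = false
  locates β i j (just (β′ , i′ , j′)) = β′ == β ∧ (i′ == i ∧ j′ == j)

  line : Fin n → Fin n → Maybe (Fin b × Fin 4 × Fin 4)
  line x y = find blocks (toℕ x) (toℕ y)

  joined : Bool
  joined = allF λ x → allF λ y → rel x y ⇒ joins x y (line x y)

  locatedAt : Fin b → Fin 4 → Fin 4 → Bool
  locatedAt β i j = not (i == j) ⇒ (rel (fobj β i) (fobj β j) ∧ locates β i j (line (fobj β i) (fobj β j)))

  located : Bool
  located = allF λ β → allF λ i → allF (locatedAt β i)

  locates-sound : ∀ {β i j} r → locates β i j r ≡ true → r ≡ just (β , i , j)
  locates-sound {β} {i} {j} (just (β′ , i′ , j′)) h =
    let (h₁ , h₂) = ∧-true {β′ == β} h
        (h₃ , h₄) = ∧-true {i′ == i} h₂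
    in cong just (cong₂ _,_ (==-sound h₁) (cong₂ _,_ (==-sound h₃) (==-sound h₄)))

  -- `find` depends on the pair of points alone. If it leads every pair of positions of every block
  -- back to that block and those positions, no pair of points can occur twice; uniqueness is thus
  -- tested without comparing blocks with each other.
  finite : joined ≡ true → located ≡ true → Cover (λ _ → _≢_) (λ x y → rel x y ≡ true) fobj
  finite hj hl = record
    { hom    = λ n → proj₁ (∧-true (at n))
    ; cover  = λ {x} {y} r → through x y (line x y) (⇒-elim (allF-sound (allF-sound hj x) y) r)
    ; unique = λ {l} {p} {q} {l′} {p′} {q′} n n′ ep eq → just-injective
        (trans (sym (locates-sound _ (proj₂ (∧-true {rel (fobj l p) (fobj l q)} (at n)))))
        (trans (cong₂ line ep eq)
               (locates-sound _ (proj₂ (∧-true {rel (fobj l′ p′) (fobj l′ q′)} (at n′))))))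
    }
    where
    at : ∀ {β i j} → i ≢ j →
         rel (fobj β i) (fobj β j) ∧ locates β i j (line (fobj β i) (fobj β j)) ≡ true
    at {β} {i} {j} n = ⇒-elim (allF-sound {f = locatedAt β i}
      (allF-sound {f = λ i → allF (locatedAt β i)} (allF-sound hl β) i) j) (≢-elim n)
    through : ∀ x y r → joins x y r ≡ true → ∃[ β ] ∃[ i ] ∃[ j ] i ≢ j × fobj β i ≡ x × fobj β j ≡ y
    through x y (just (β , i , j)) h =
      let (h₁ , h₂) = ∧-true {not (i == j)} h
          (h₃ , h₄) = ∧-true {fobj β i == x} h₂
      in β , i , j , ≢-intro h₁ , ==-sound h₃ , ==-sound h₄

  kindAt : (Fin n → Bool) → Fin b → Fin 4 → Bool
  kindAt isC β i = isC (fobj β i) ⇔ᵇ isZero i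

  kinds : (Fin n → Bool) → Bool
  kinds isC = allF λ β → allF (kindAt isC β)

  finiteResolved : (isC : Fin n → Bool) → joined ≡ true → located ≡ true → kinds isC ≡ true →
                   Resolved isC (λ x y → rel x y ≡ true)
  finiteResolved isC hj hl hk = record
    { Block = _ ; obj = fobj ; covers = finite hj hl
    ; kind = λ β i → ⇔ᵇ-sound _ _ (allF-sound {f = kindAt isC β} (allF-sound {f = λ β → allF (kindAt isC β)} hk β) i)
    }

module _ (m k : ℕ) where

  apart : Fin (m * k) → Fin (m * k) → Bool
  apart x y = not (proj₁ (remQuot {m} k x) == proj₁ (remQuot {m} k y))

  ungroup : Cover {⊤} (λ _ x y → apart x y ≡ true) (_≢_ ⊗ Any) (λ _ → remQuot {m} k)
  ungroup = iso (remQuot k) (uncurry combine) (combine-remQuot {m} k) (uncurry (remQuot-combine {m}))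
                (λ h → ≢-intro h , tt) (λ (n , _) → ≢-elim n)

module _ (m : ℕ) where

  holeOf : Fin (m * 3) → Fin m
  holeOf = proj₁ ∘ remQuot {m} 3

  tag : Fin (m * 3) → Bool
  tag = isZero ∘ proj₂ ∘ remQuot {m} 3

  frameRel : Fin (m * 3) → Fin (m * 3) → Bool
  frameRel x y = not (holeOf x == holeOf y) ∧ not (tag x ∧ tag y)

  frame : {b : ℕ} {{_ : NonZero (m * 3)}} (blocks : Vec (Vec ℕ 4) b) → let open Finite (m * 3) frameRel blocks in
          joined ≡ true → located ≡ true → kinds tag ≡ true → Frame {Fin m} _≢_
  frame blocks hj hl hk = resolve
    (iso (remQuot {m} 3) (uncurry combine) (combine-remQuot {m} 3) (uncurry (remQuot-combine {m}))
         (λ h → let (h₁ , h₂) = ∧-true h in ≢-intro h₁ , λ (e , e′) → not-elim h₂ (∧-intro e e′))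
         (λ (n , s) → ∧-intro (≢-elim n) (not-true (λ h → s (∧-true h)))))
    (λ _ _ → refl)
    (λ _ → finiteResolved tag hj hl hk)
    where open Finite (m * 3) frameRel blocks

-- Difference matrices

-- Componentwise arithmetic in a product of cyclic groups: digits are combined without carries, the
-- least significant one first.
digitwise : (ℕ → ℕ → ℕ → ℕ) → List ℕ → ℕ → ℕ → ℕ
digitwise op []           x y = 0
digitwise op (zero ∷ _)   x y = 0
digitwise op (r@(suc _) ∷ rs) x y = op r (x % r) (y % r) % r + r * digitwise op rs (x / r) (y / r)

plus minus : List ℕ → ℕ → ℕ → ℕ
plus  = digitwise (λ r a b → a + b)
minus = digitwise (λ r a b → a + (r ∸ b))

nth : List ℕ → ℕ → ℕ
nth []       _       = 0
nth (x ∷ xs) zero    = x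
nth (x ∷ xs) (suc n) = nth xs n

search : ∀ {n} → (Fin n → Bool) → Maybe (Fin n)
search {zero}  f = nothing
search {suc n} f = if f zero then just zero else Maybe.map suc (search (f ∘ suc))

search-sound : ∀ {n} (f : Fin n → Bool) {i} → search f ≡ just i → f i ≡ true
search-sound {suc n} f h with f zero in eq
search-sound {suc n} f refl | true = eq
search-sound {suc n} f h    | false with search (f ∘ suc) in eq′
search-sound {suc n} f refl | false | just i = search-sound (f ∘ suc) eq′

found : ∀ {n} → Maybe (Fin n) → Bool
found (just _) = true
found nothing  = false

_==?_ : ∀ {n} → Maybe (Fin n) → Fin n → Bool
nothing ==? _ = false
just i  ==? j = i == j

-- The rows form a difference matrix over Z_r × Z_s × …, whose elements are written as mixed-radix numerals
-- for the radices r ∷ s ∷ ….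
module Difference (m : ℕ) {{_ : NonZero m}} (radices : List ℕ) {k : ℕ} (rows : Vec (List ℕ) k) where

  entry : Fin k → Fin m → ℕ
  entry i b = nth (lookup rows i) (toℕ b)

  to from : Fin k → Fin m → Fin m → Fin m
  to   i a b = plus  radices (toℕ a) (entry i b) mod m
  from i y b = minus radices (toℕ y) (entry i b) mod m

  shift : Fin k → Fin k → Fin m → Fin m → Fin m
  shift i j y b = to j (from i y b) b

  inverse surjective injective : Bool
  inverse    = allF λ i → allF λ y → allF λ b → to i (from i y b) b == y ∧ from i (to i y b) b == y
  surjective = allF λ i → allF λ j → allF λ y → allF λ z → not (i == j) ⇒ found (search (λ b → shift i j y b == z))
  injective  = allF λ i → allF λ j → allF λ y → allF λ b → not (i == j) ⇒
               (search (λ b′ → shift i j y b′ == shift i j y b) ==? b)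

  -- Developing the rows over the group gives one point group per row, and the column index `b`
  -- supplies a further one. A block through `y` in group `i` has `a = from i y b` and meets group
  -- `j` in `shift i j y b`; the difference property makes this a bijection in `b`. Its injectivity
  -- is tested by searching for the value at `b`, where the first hit has to be `b` itself.
  td : inverse ≡ true → surjective ≡ true → injective ≡ true → TD k m
  td hi hs hj = record
    { f     = to
    ; meet₂ = λ {i} {j} n y z → let (b , e) = meets i j n y z in from i y b , b , to-from i y b , e
    ; uniq₂ = λ {i} {j} n {a} {b} {a′} {b′} e e′ → uniq i j n a b a′ b′ e e′
    ; meet₁ = λ i y b → from i y b , to-from i y b
    ; uniq₁ = λ i {a} {a′} b e → trans (sym (from-to i a b)) (trans (cong (λ y → from i y b) e) (from-to i a′ b))
    }
    where
    inv : ∀ i y b → to i (from i y b) b == y ∧ from i (to i y b) b == y ≡ true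
    inv i y b = allF-sound (allF-sound (allF-sound hi i) y) b
    to-from : ∀ i y b → to i (from i y b) b ≡ y
    to-from i y b = ==-sound (proj₁ (∧-true (inv i y b)))
    from-to : ∀ i a b → from i (to i a b) b ≡ a
    from-to i a b = ==-sound (proj₂ (∧-true {to i (from i a b) b == a} (inv i a b)))
    meets : ∀ i j → i ≢ j → ∀ y z → ∃[ b ] shift i j y b ≡ z
    meets i j n y z = result _ refl (⇒-elim (allF-sound (allF-sound (allF-sound (allF-sound hs i) j) y) z) (≢-elim n))
      where
      result : ∀ r → search (λ b → shift i j y b == z) ≡ r → found r ≡ true → ∃[ b ] shift i j y b ≡ z
      result (just b) e _ = b , ==-sound (search-sound (λ b → shift i j y b == z) e)
    first : ∀ {r : Maybe (Fin m)} {b} → r ==? b ≡ true → r ≡ just b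
    first {just _} h = cong just (==-sound h)
    inj : ∀ i j → i ≢ j → ∀ y b b′ → shift i j y b ≡ shift i j y b′ → b ≡ b′
    inj i j n y b b′ e = just-injective (trans (sym (at b))
      (trans (cong (λ z → search (λ b′ → shift i j y b′ == z)) e) (at b′)))
      where
      at : ∀ b → search (λ b′ → shift i j y b′ == shift i j y b) ≡ just b
      at b = first (⇒-elim (allF-sound (allF-sound (allF-sound (allF-sound hj i) j) y) b) (≢-elim n))
    uniq : ∀ i j → i ≢ j → ∀ a b a′ b′ → to i a b ≡ to i a′ b′ → to j a b ≡ to j a′ b′ → (a , b) ≡ (a′ , b′)
    uniq i j n a b a′ b′ e e′ = cong₂ _,_ (trans a≡ (trans (cong (from i y) b≡) (sym a′≡))) b≡
      where
      y : Fin m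
      y = to i a b
      a≡ : a ≡ from i y b
      a≡ = sym (from-to i a b)
      a′≡ : a′ ≡ from i y b′
      a′≡ = trans (sym (from-to i a′ b′)) (cong (λ y → from i y b′) (sym e))
      b≡ : b ≡ b′
      b≡ = inj i j n y b b′ (trans (cong (λ a → to j a b) (sym a≡)) (trans e′ (cong (λ a → to j a b′) a′≡)))

-- Tables of small designs

-- AG(2,3) and a KTS(15) punctured at a point: 3 c + b stands for the object (c , b) of a frame.
kts9Blocks : Vec (Vec ℕ 4) 8
kts9Blocks =
  (0 ∷ 4 ∷ 7 ∷ 11 ∷ []) ∷ (0 ∷ 5 ∷ 10 ∷ 8 ∷ []) ∷ (3 ∷ 1 ∷ 7 ∷ 10 ∷ []) ∷ (3 ∷ 2 ∷ 11 ∷ 8 ∷ []) ∷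
  (6 ∷ 4 ∷ 10 ∷ 2 ∷ []) ∷ (6 ∷ 5 ∷ 1 ∷ 11 ∷ []) ∷ (9 ∷ 4 ∷ 1 ∷ 8 ∷ []) ∷ (9 ∷ 5 ∷ 7 ∷ 2 ∷ []) ∷ []

kts15Blocks : Vec (Vec ℕ 4) 28
kts15Blocks =
  (0 ∷ 4 ∷ 11 ∷ 14 ∷ []) ∷ (0 ∷ 5 ∷ 16 ∷ 20 ∷ []) ∷ (0 ∷ 7 ∷ 13 ∷ 19 ∷ []) ∷ (0 ∷ 8 ∷ 10 ∷ 17 ∷ []) ∷
  (3 ∷ 8 ∷ 11 ∷ 16 ∷ []) ∷ (3 ∷ 2 ∷ 13 ∷ 17 ∷ []) ∷ (3 ∷ 1 ∷ 10 ∷ 19 ∷ []) ∷ (3 ∷ 7 ∷ 14 ∷ 20 ∷ []) ∷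
  (6 ∷ 1 ∷ 14 ∷ 17 ∷ []) ∷ (6 ∷ 2 ∷ 10 ∷ 20 ∷ []) ∷ (6 ∷ 4 ∷ 16 ∷ 19 ∷ []) ∷ (6 ∷ 5 ∷ 11 ∷ 13 ∷ []) ∷
  (9 ∷ 8 ∷ 13 ∷ 20 ∷ []) ∷ (9 ∷ 1 ∷ 4 ∷ 7 ∷ []) ∷ (9 ∷ 5 ∷ 17 ∷ 19 ∷ []) ∷ (9 ∷ 2 ∷ 14 ∷ 16 ∷ []) ∷
  (12 ∷ 7 ∷ 10 ∷ 16 ∷ []) ∷ (12 ∷ 2 ∷ 11 ∷ 19 ∷ []) ∷ (12 ∷ 4 ∷ 17 ∷ 20 ∷ []) ∷ (12 ∷ 1 ∷ 5 ∷ 8 ∷ []) ∷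
  (15 ∷ 4 ∷ 10 ∷ 13 ∷ []) ∷ (15 ∷ 1 ∷ 11 ∷ 20 ∷ []) ∷ (15 ∷ 8 ∷ 14 ∷ 19 ∷ []) ∷ (15 ∷ 2 ∷ 5 ∷ 7 ∷ []) ∷
  (18 ∷ 1 ∷ 13 ∷ 16 ∷ []) ∷ (18 ∷ 5 ∷ 10 ∷ 14 ∷ []) ∷ (18 ∷ 2 ∷ 4 ∷ 8 ∷ []) ∷ (18 ∷ 7 ∷ 11 ∷ 17 ∷ []) ∷ []

-- The translates of {0, 1, 3, 9} modulo 13.
plane13Blocks : Vec (Vec ℕ 4) 13
plane13Blocks =
  (0 ∷ 1 ∷ 3 ∷ 9 ∷ []) ∷ (1 ∷ 2 ∷ 4 ∷ 10 ∷ []) ∷ (2 ∷ 3 ∷ 5 ∷ 11 ∷ []) ∷ (3 ∷ 4 ∷ 6 ∷ 12 ∷ []) ∷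
  (0 ∷ 4 ∷ 5 ∷ 7 ∷ []) ∷ (1 ∷ 5 ∷ 6 ∷ 8 ∷ []) ∷ (2 ∷ 6 ∷ 7 ∷ 9 ∷ []) ∷ (3 ∷ 7 ∷ 8 ∷ 10 ∷ []) ∷
  (4 ∷ 8 ∷ 9 ∷ 11 ∷ []) ∷ (5 ∷ 9 ∷ 10 ∷ 12 ∷ []) ∷ (0 ∷ 6 ∷ 10 ∷ 11 ∷ []) ∷ (1 ∷ 7 ∷ 11 ∷ 12 ∷ []) ∷
  (0 ∷ 2 ∷ 8 ∷ 12 ∷ []) ∷ []

-- Group divisible designs with k groups of size 3, obtained from (3 k + 1, 4, 1)-designs by deleting a point:
-- AG(2,4), and difference families over Z₅², Z₃³ ∪ {∞} and Z₃₇.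
gdd5Blocks : Vec (Vec ℕ 4) 15
gdd5Blocks =
  (0 ∷ 3 ∷ 6 ∷ 9 ∷ []) ∷ (0 ∷ 4 ∷ 8 ∷ 14 ∷ []) ∷ (0 ∷ 5 ∷ 10 ∷ 13 ∷ []) ∷ (0 ∷ 7 ∷ 11 ∷ 12 ∷ []) ∷
  (1 ∷ 3 ∷ 11 ∷ 14 ∷ []) ∷ (1 ∷ 4 ∷ 7 ∷ 10 ∷ []) ∷ (1 ∷ 5 ∷ 6 ∷ 12 ∷ []) ∷ (1 ∷ 8 ∷ 9 ∷ 13 ∷ []) ∷
  (2 ∷ 3 ∷ 7 ∷ 13 ∷ []) ∷ (2 ∷ 4 ∷ 9 ∷ 12 ∷ []) ∷ (2 ∷ 5 ∷ 8 ∷ 11 ∷ []) ∷ (2 ∷ 6 ∷ 10 ∷ 14 ∷ []) ∷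
  (3 ∷ 8 ∷ 10 ∷ 12 ∷ []) ∷ (4 ∷ 6 ∷ 11 ∷ 13 ∷ []) ∷ (5 ∷ 7 ∷ 9 ∷ 14 ∷ []) ∷ []

gdd8Blocks : Vec (Vec ℕ 4) 42
gdd8Blocks =
  (0 ∷ 3 ∷ 9 ∷ 20 ∷ []) ∷ (0 ∷ 4 ∷ 6 ∷ 15 ∷ []) ∷ (0 ∷ 5 ∷ 14 ∷ 21 ∷ []) ∷ (0 ∷ 7 ∷ 17 ∷ 23 ∷ []) ∷
  (0 ∷ 8 ∷ 10 ∷ 18 ∷ []) ∷ (0 ∷ 11 ∷ 13 ∷ 22 ∷ []) ∷ (0 ∷ 12 ∷ 16 ∷ 19 ∷ []) ∷ (1 ∷ 3 ∷ 7 ∷ 12 ∷ []) ∷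
  (1 ∷ 4 ∷ 20 ∷ 21 ∷ []) ∷ (1 ∷ 5 ∷ 10 ∷ 13 ∷ []) ∷ (1 ∷ 6 ∷ 11 ∷ 17 ∷ []) ∷ (1 ∷ 8 ∷ 15 ∷ 23 ∷ []) ∷
  (1 ∷ 9 ∷ 19 ∷ 22 ∷ []) ∷ (1 ∷ 14 ∷ 16 ∷ 18 ∷ []) ∷ (2 ∷ 3 ∷ 17 ∷ 21 ∷ []) ∷ (2 ∷ 4 ∷ 11 ∷ 16 ∷ []) ∷
  (2 ∷ 5 ∷ 8 ∷ 20 ∷ []) ∷ (2 ∷ 6 ∷ 12 ∷ 18 ∷ []) ∷ (2 ∷ 7 ∷ 9 ∷ 13 ∷ []) ∷ (2 ∷ 10 ∷ 15 ∷ 22 ∷ []) ∷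
  (2 ∷ 14 ∷ 19 ∷ 23 ∷ []) ∷ (3 ∷ 6 ∷ 14 ∷ 22 ∷ []) ∷ (3 ∷ 8 ∷ 11 ∷ 19 ∷ []) ∷ (3 ∷ 10 ∷ 16 ∷ 23 ∷ []) ∷
  (3 ∷ 13 ∷ 15 ∷ 18 ∷ []) ∷ (4 ∷ 7 ∷ 10 ∷ 14 ∷ []) ∷ (4 ∷ 8 ∷ 12 ∷ 22 ∷ []) ∷ (4 ∷ 9 ∷ 18 ∷ 23 ∷ []) ∷
  (4 ∷ 13 ∷ 17 ∷ 19 ∷ []) ∷ (5 ∷ 6 ∷ 9 ∷ 16 ∷ []) ∷ (5 ∷ 7 ∷ 15 ∷ 19 ∷ []) ∷ (5 ∷ 11 ∷ 12 ∷ 23 ∷ []) ∷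
  (5 ∷ 17 ∷ 18 ∷ 22 ∷ []) ∷ (6 ∷ 10 ∷ 19 ∷ 21 ∷ []) ∷ (6 ∷ 13 ∷ 20 ∷ 23 ∷ []) ∷ (7 ∷ 11 ∷ 18 ∷ 21 ∷ []) ∷
  (7 ∷ 16 ∷ 20 ∷ 22 ∷ []) ∷ (8 ∷ 9 ∷ 14 ∷ 17 ∷ []) ∷ (8 ∷ 13 ∷ 16 ∷ 21 ∷ []) ∷ (9 ∷ 12 ∷ 15 ∷ 21 ∷ []) ∷
  (10 ∷ 12 ∷ 17 ∷ 20 ∷ []) ∷ (11 ∷ 14 ∷ 15 ∷ 20 ∷ []) ∷ []

gdd9Blocks : Vec (Vec ℕ 4) 54
gdd9Blocks =
  (0 ∷ 3 ∷ 9 ∷ 13 ∷ []) ∷ (0 ∷ 4 ∷ 18 ∷ 21 ∷ []) ∷ (0 ∷ 5 ∷ 16 ∷ 24 ∷ []) ∷ (0 ∷ 6 ∷ 10 ∷ 15 ∷ []) ∷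
  (0 ∷ 7 ∷ 14 ∷ 22 ∷ []) ∷ (0 ∷ 8 ∷ 20 ∷ 26 ∷ []) ∷ (0 ∷ 11 ∷ 23 ∷ 25 ∷ []) ∷ (0 ∷ 12 ∷ 17 ∷ 19 ∷ []) ∷
  (1 ∷ 3 ∷ 17 ∷ 25 ∷ []) ∷ (1 ∷ 4 ∷ 10 ∷ 14 ∷ []) ∷ (1 ∷ 5 ∷ 19 ∷ 22 ∷ []) ∷ (1 ∷ 6 ∷ 18 ∷ 24 ∷ []) ∷
  (1 ∷ 7 ∷ 11 ∷ 16 ∷ []) ∷ (1 ∷ 8 ∷ 12 ∷ 23 ∷ []) ∷ (1 ∷ 9 ∷ 21 ∷ 26 ∷ []) ∷ (1 ∷ 13 ∷ 15 ∷ 20 ∷ []) ∷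
  (2 ∷ 3 ∷ 20 ∷ 23 ∷ []) ∷ (2 ∷ 4 ∷ 15 ∷ 26 ∷ []) ∷ (2 ∷ 5 ∷ 11 ∷ 12 ∷ []) ∷ (2 ∷ 6 ∷ 13 ∷ 21 ∷ []) ∷
  (2 ∷ 7 ∷ 19 ∷ 25 ∷ []) ∷ (2 ∷ 8 ∷ 9 ∷ 17 ∷ []) ∷ (2 ∷ 10 ∷ 22 ∷ 24 ∷ []) ∷ (2 ∷ 14 ∷ 16 ∷ 18 ∷ []) ∷
  (3 ∷ 6 ∷ 12 ∷ 16 ∷ []) ∷ (3 ∷ 7 ∷ 21 ∷ 24 ∷ []) ∷ (3 ∷ 8 ∷ 10 ∷ 18 ∷ []) ∷ (3 ∷ 11 ∷ 15 ∷ 22 ∷ []) ∷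
  (3 ∷ 14 ∷ 19 ∷ 26 ∷ []) ∷ (4 ∷ 6 ∷ 11 ∷ 19 ∷ []) ∷ (4 ∷ 7 ∷ 13 ∷ 17 ∷ []) ∷ (4 ∷ 8 ∷ 22 ∷ 25 ∷ []) ∷
  (4 ∷ 9 ∷ 16 ∷ 23 ∷ []) ∷ (4 ∷ 12 ∷ 20 ∷ 24 ∷ []) ∷ (5 ∷ 6 ∷ 23 ∷ 26 ∷ []) ∷ (5 ∷ 7 ∷ 9 ∷ 20 ∷ []) ∷
  (5 ∷ 8 ∷ 14 ∷ 15 ∷ []) ∷ (5 ∷ 10 ∷ 17 ∷ 21 ∷ []) ∷ (5 ∷ 13 ∷ 18 ∷ 25 ∷ []) ∷ (6 ∷ 9 ∷ 14 ∷ 25 ∷ []) ∷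
  (6 ∷ 17 ∷ 20 ∷ 22 ∷ []) ∷ (7 ∷ 10 ∷ 12 ∷ 26 ∷ []) ∷ (7 ∷ 15 ∷ 18 ∷ 23 ∷ []) ∷ (8 ∷ 11 ∷ 13 ∷ 24 ∷ []) ∷
  (8 ∷ 16 ∷ 19 ∷ 21 ∷ []) ∷ (9 ∷ 12 ∷ 18 ∷ 22 ∷ []) ∷ (9 ∷ 15 ∷ 19 ∷ 24 ∷ []) ∷ (10 ∷ 13 ∷ 19 ∷ 23 ∷ []) ∷
  (10 ∷ 16 ∷ 20 ∷ 25 ∷ []) ∷ (11 ∷ 14 ∷ 20 ∷ 21 ∷ []) ∷ (11 ∷ 17 ∷ 18 ∷ 26 ∷ []) ∷ (12 ∷ 15 ∷ 21 ∷ 25 ∷ []) ∷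
  (13 ∷ 16 ∷ 22 ∷ 26 ∷ []) ∷ (14 ∷ 17 ∷ 23 ∷ 24 ∷ []) ∷ []

gdd12Blocks : Vec (Vec ℕ 4) 99
gdd12Blocks =
  (0 ∷ 3 ∷ 31 ∷ 35 ∷ []) ∷ (0 ∷ 4 ∷ 14 ∷ 25 ∷ []) ∷ (0 ∷ 5 ∷ 21 ∷ 33 ∷ []) ∷ (0 ∷ 6 ∷ 13 ∷ 19 ∷ []) ∷
  (0 ∷ 7 ∷ 18 ∷ 27 ∷ []) ∷ (0 ∷ 8 ∷ 11 ∷ 15 ∷ []) ∷ (0 ∷ 9 ∷ 12 ∷ 26 ∷ []) ∷ (0 ∷ 10 ∷ 20 ∷ 32 ∷ []) ∷
  (0 ∷ 16 ∷ 30 ∷ 34 ∷ []) ∷ (0 ∷ 17 ∷ 22 ∷ 28 ∷ []) ∷ (0 ∷ 23 ∷ 24 ∷ 29 ∷ []) ∷ (1 ∷ 3 ∷ 6 ∷ 23 ∷ []) ∷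
  (1 ∷ 4 ∷ 11 ∷ 30 ∷ []) ∷ (1 ∷ 5 ∷ 25 ∷ 28 ∷ []) ∷ (1 ∷ 7 ∷ 26 ∷ 29 ∷ []) ∷ (1 ∷ 8 ∷ 13 ∷ 17 ∷ []) ∷
  (1 ∷ 9 ∷ 16 ∷ 21 ∷ []) ∷ (1 ∷ 10 ∷ 22 ∷ 35 ∷ []) ∷ (1 ∷ 12 ∷ 18 ∷ 32 ∷ []) ∷ (1 ∷ 14 ∷ 15 ∷ 20 ∷ []) ∷
  (1 ∷ 19 ∷ 31 ∷ 33 ∷ []) ∷ (1 ∷ 24 ∷ 27 ∷ 34 ∷ []) ∷ (2 ∷ 3 ∷ 13 ∷ 34 ∷ []) ∷ (2 ∷ 4 ∷ 20 ∷ 24 ∷ []) ∷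
  (2 ∷ 5 ∷ 11 ∷ 18 ∷ []) ∷ (2 ∷ 6 ∷ 15 ∷ 30 ∷ []) ∷ (2 ∷ 7 ∷ 21 ∷ 25 ∷ []) ∷ (2 ∷ 8 ∷ 29 ∷ 31 ∷ []) ∷
  (2 ∷ 9 ∷ 19 ∷ 23 ∷ []) ∷ (2 ∷ 10 ∷ 16 ∷ 33 ∷ []) ∷ (2 ∷ 12 ∷ 17 ∷ 27 ∷ []) ∷ (2 ∷ 14 ∷ 28 ∷ 35 ∷ []) ∷
  (2 ∷ 22 ∷ 26 ∷ 32 ∷ []) ∷ (3 ∷ 7 ∷ 22 ∷ 33 ∷ []) ∷ (3 ∷ 8 ∷ 9 ∷ 24 ∷ []) ∷ (3 ∷ 10 ∷ 17 ∷ 18 ∷ []) ∷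
  (3 ∷ 11 ∷ 14 ∷ 27 ∷ []) ∷ (3 ∷ 12 ∷ 28 ∷ 30 ∷ []) ∷ (3 ∷ 15 ∷ 19 ∷ 25 ∷ []) ∷ (3 ∷ 16 ∷ 29 ∷ 32 ∷ []) ∷
  (3 ∷ 20 ∷ 21 ∷ 26 ∷ []) ∷ (4 ∷ 6 ∷ 9 ∷ 17 ∷ []) ∷ (4 ∷ 7 ∷ 12 ∷ 15 ∷ []) ∷ (4 ∷ 8 ∷ 22 ∷ 27 ∷ []) ∷
  (4 ∷ 10 ∷ 29 ∷ 34 ∷ []) ∷ (4 ∷ 13 ∷ 21 ∷ 31 ∷ []) ∷ (4 ∷ 16 ∷ 18 ∷ 23 ∷ []) ∷ (4 ∷ 19 ∷ 32 ∷ 35 ∷ []) ∷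
  (4 ∷ 26 ∷ 28 ∷ 33 ∷ []) ∷ (5 ∷ 6 ∷ 27 ∷ 32 ∷ []) ∷ (5 ∷ 7 ∷ 13 ∷ 16 ∷ []) ∷ (5 ∷ 8 ∷ 19 ∷ 30 ∷ []) ∷
  (5 ∷ 9 ∷ 14 ∷ 34 ∷ []) ∷ (5 ∷ 10 ∷ 12 ∷ 23 ∷ []) ∷ (5 ∷ 15 ∷ 22 ∷ 24 ∷ []) ∷ (5 ∷ 17 ∷ 26 ∷ 31 ∷ []) ∷
  (5 ∷ 20 ∷ 29 ∷ 35 ∷ []) ∷ (6 ∷ 10 ∷ 24 ∷ 31 ∷ []) ∷ (6 ∷ 11 ∷ 26 ∷ 35 ∷ []) ∷ (6 ∷ 12 ∷ 22 ∷ 29 ∷ []) ∷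
  (6 ∷ 14 ∷ 18 ∷ 33 ∷ []) ∷ (6 ∷ 16 ∷ 20 ∷ 25 ∷ []) ∷ (6 ∷ 21 ∷ 28 ∷ 34 ∷ []) ∷ (7 ∷ 9 ∷ 30 ∷ 35 ∷ []) ∷
  (7 ∷ 10 ∷ 19 ∷ 28 ∷ []) ∷ (7 ∷ 11 ∷ 23 ∷ 31 ∷ []) ∷ (7 ∷ 14 ∷ 24 ∷ 32 ∷ []) ∷ (7 ∷ 17 ∷ 20 ∷ 34 ∷ []) ∷
  (8 ∷ 10 ∷ 14 ∷ 21 ∷ []) ∷ (8 ∷ 12 ∷ 16 ∷ 35 ∷ []) ∷ (8 ∷ 18 ∷ 26 ∷ 34 ∷ []) ∷ (8 ∷ 20 ∷ 23 ∷ 28 ∷ []) ∷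
  (8 ∷ 25 ∷ 32 ∷ 33 ∷ []) ∷ (9 ∷ 13 ∷ 28 ∷ 32 ∷ []) ∷ (9 ∷ 15 ∷ 29 ∷ 33 ∷ []) ∷ (9 ∷ 18 ∷ 22 ∷ 25 ∷ []) ∷
  (9 ∷ 20 ∷ 27 ∷ 31 ∷ []) ∷ (10 ∷ 13 ∷ 15 ∷ 26 ∷ []) ∷ (10 ∷ 25 ∷ 27 ∷ 30 ∷ []) ∷ (11 ∷ 12 ∷ 20 ∷ 33 ∷ []) ∷
  (11 ∷ 13 ∷ 25 ∷ 29 ∷ []) ∷ (11 ∷ 16 ∷ 24 ∷ 28 ∷ []) ∷ (11 ∷ 17 ∷ 21 ∷ 32 ∷ []) ∷ (11 ∷ 19 ∷ 22 ∷ 34 ∷ []) ∷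
  (12 ∷ 19 ∷ 21 ∷ 24 ∷ []) ∷ (12 ∷ 25 ∷ 31 ∷ 34 ∷ []) ∷ (13 ∷ 18 ∷ 24 ∷ 35 ∷ []) ∷ (13 ∷ 20 ∷ 22 ∷ 30 ∷ []) ∷
  (13 ∷ 23 ∷ 27 ∷ 33 ∷ []) ∷ (14 ∷ 16 ∷ 22 ∷ 31 ∷ []) ∷ (14 ∷ 17 ∷ 19 ∷ 29 ∷ []) ∷ (14 ∷ 23 ∷ 26 ∷ 30 ∷ []) ∷
  (15 ∷ 18 ∷ 28 ∷ 31 ∷ []) ∷ (15 ∷ 21 ∷ 27 ∷ 35 ∷ []) ∷ (15 ∷ 23 ∷ 32 ∷ 34 ∷ []) ∷ (16 ∷ 19 ∷ 26 ∷ 27 ∷ []) ∷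
  (17 ∷ 23 ∷ 25 ∷ 35 ∷ []) ∷ (17 ∷ 24 ∷ 30 ∷ 33 ∷ []) ∷ (18 ∷ 21 ∷ 29 ∷ 30 ∷ []) ∷ []

-- Each line of AG(2,4), doubled and with ∞ added, carries a copy of AG(2,3). Here 0 is ∞, 1, …, 16 are the parallel classes
-- and 17, …, 48 the other points, numbered so that x ↦ (x − 17) mod 4 (and 0 ↦ 0) is an equitable proper colouring.
kts33Blocks : Vec (Vec ℕ 4) 176
kts33Blocks =
  (1 ∷ 19 ∷ 17 ∷ 0 ∷ []) ∷ (2 ∷ 21 ∷ 20 ∷ 0 ∷ []) ∷ (3 ∷ 24 ∷ 28 ∷ 0 ∷ []) ∷ (4 ∷ 23 ∷ 27 ∷ 0 ∷ []) ∷
  (5 ∷ 32 ∷ 18 ∷ 0 ∷ []) ∷ (6 ∷ 25 ∷ 22 ∷ 0 ∷ []) ∷ (7 ∷ 29 ∷ 36 ∷ 0 ∷ []) ∷ (8 ∷ 26 ∷ 40 ∷ 0 ∷ []) ∷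
  (9 ∷ 33 ∷ 44 ∷ 0 ∷ []) ∷ (10 ∷ 48 ∷ 31 ∷ 0 ∷ []) ∷ (11 ∷ 35 ∷ 37 ∷ 0 ∷ []) ∷ (12 ∷ 39 ∷ 30 ∷ 0 ∷ []) ∷
  (13 ∷ 43 ∷ 41 ∷ 0 ∷ []) ∷ (14 ∷ 34 ∷ 47 ∷ 0 ∷ []) ∷ (15 ∷ 45 ∷ 38 ∷ 0 ∷ []) ∷ (16 ∷ 42 ∷ 46 ∷ 0 ∷ []) ∷
  (1 ∷ 32 ∷ 33 ∷ 41 ∷ []) ∷ (1 ∷ 18 ∷ 43 ∷ 44 ∷ []) ∷ (5 ∷ 19 ∷ 33 ∷ 43 ∷ []) ∷ (5 ∷ 17 ∷ 41 ∷ 44 ∷ []) ∷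
  (9 ∷ 32 ∷ 43 ∷ 17 ∷ []) ∷ (9 ∷ 18 ∷ 19 ∷ 41 ∷ []) ∷ (13 ∷ 32 ∷ 19 ∷ 44 ∷ []) ∷ (13 ∷ 18 ∷ 33 ∷ 17 ∷ []) ∷
  (2 ∷ 25 ∷ 48 ∷ 47 ∷ []) ∷ (2 ∷ 22 ∷ 34 ∷ 31 ∷ []) ∷ (6 ∷ 21 ∷ 48 ∷ 34 ∷ []) ∷ (6 ∷ 20 ∷ 47 ∷ 31 ∷ []) ∷
  (10 ∷ 25 ∷ 34 ∷ 20 ∷ []) ∷ (10 ∷ 22 ∷ 21 ∷ 47 ∷ []) ∷ (14 ∷ 25 ∷ 21 ∷ 31 ∷ []) ∷ (14 ∷ 22 ∷ 48 ∷ 20 ∷ []) ∷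
  (3 ∷ 29 ∷ 35 ∷ 38 ∷ []) ∷ (3 ∷ 36 ∷ 45 ∷ 37 ∷ []) ∷ (7 ∷ 24 ∷ 35 ∷ 45 ∷ []) ∷ (7 ∷ 28 ∷ 38 ∷ 37 ∷ []) ∷
  (11 ∷ 29 ∷ 45 ∷ 28 ∷ []) ∷ (11 ∷ 36 ∷ 24 ∷ 38 ∷ []) ∷ (15 ∷ 29 ∷ 24 ∷ 37 ∷ []) ∷ (15 ∷ 36 ∷ 35 ∷ 28 ∷ []) ∷
  (4 ∷ 26 ∷ 39 ∷ 46 ∷ []) ∷ (4 ∷ 40 ∷ 42 ∷ 30 ∷ []) ∷ (8 ∷ 23 ∷ 39 ∷ 42 ∷ []) ∷ (8 ∷ 27 ∷ 46 ∷ 30 ∷ []) ∷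
  (12 ∷ 26 ∷ 42 ∷ 27 ∷ []) ∷ (12 ∷ 40 ∷ 23 ∷ 46 ∷ []) ∷ (16 ∷ 26 ∷ 23 ∷ 30 ∷ []) ∷ (16 ∷ 40 ∷ 39 ∷ 27 ∷ []) ∷
  (1 ∷ 25 ∷ 35 ∷ 46 ∷ []) ∷ (1 ∷ 22 ∷ 42 ∷ 37 ∷ []) ∷ (6 ∷ 19 ∷ 35 ∷ 42 ∷ []) ∷ (6 ∷ 17 ∷ 46 ∷ 37 ∷ []) ∷
  (11 ∷ 25 ∷ 42 ∷ 17 ∷ []) ∷ (11 ∷ 22 ∷ 19 ∷ 46 ∷ []) ∷ (16 ∷ 25 ∷ 19 ∷ 37 ∷ []) ∷ (16 ∷ 22 ∷ 35 ∷ 17 ∷ []) ∷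
  (2 ∷ 32 ∷ 39 ∷ 38 ∷ []) ∷ (2 ∷ 18 ∷ 45 ∷ 30 ∷ []) ∷ (5 ∷ 21 ∷ 39 ∷ 45 ∷ []) ∷ (5 ∷ 20 ∷ 38 ∷ 30 ∷ []) ∷
  (12 ∷ 32 ∷ 45 ∷ 20 ∷ []) ∷ (12 ∷ 18 ∷ 21 ∷ 38 ∷ []) ∷ (15 ∷ 32 ∷ 21 ∷ 30 ∷ []) ∷ (15 ∷ 18 ∷ 39 ∷ 20 ∷ []) ∷
  (3 ∷ 26 ∷ 33 ∷ 47 ∷ []) ∷ (3 ∷ 40 ∷ 34 ∷ 44 ∷ []) ∷ (8 ∷ 24 ∷ 33 ∷ 34 ∷ []) ∷ (8 ∷ 28 ∷ 47 ∷ 44 ∷ []) ∷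
  (9 ∷ 26 ∷ 34 ∷ 28 ∷ []) ∷ (9 ∷ 40 ∷ 24 ∷ 47 ∷ []) ∷ (14 ∷ 26 ∷ 24 ∷ 44 ∷ []) ∷ (14 ∷ 40 ∷ 33 ∷ 28 ∷ []) ∷
  (4 ∷ 29 ∷ 48 ∷ 41 ∷ []) ∷ (4 ∷ 36 ∷ 43 ∷ 31 ∷ []) ∷ (7 ∷ 23 ∷ 48 ∷ 43 ∷ []) ∷ (7 ∷ 27 ∷ 41 ∷ 31 ∷ []) ∷
  (10 ∷ 29 ∷ 43 ∷ 27 ∷ []) ∷ (10 ∷ 36 ∷ 23 ∷ 41 ∷ []) ∷ (13 ∷ 29 ∷ 23 ∷ 31 ∷ []) ∷ (13 ∷ 36 ∷ 48 ∷ 27 ∷ []) ∷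
  (1 ∷ 29 ∷ 39 ∷ 47 ∷ []) ∷ (1 ∷ 36 ∷ 34 ∷ 30 ∷ []) ∷ (7 ∷ 19 ∷ 39 ∷ 34 ∷ []) ∷ (7 ∷ 17 ∷ 47 ∷ 30 ∷ []) ∷
  (12 ∷ 29 ∷ 34 ∷ 17 ∷ []) ∷ (12 ∷ 36 ∷ 19 ∷ 47 ∷ []) ∷ (14 ∷ 29 ∷ 19 ∷ 30 ∷ []) ∷ (14 ∷ 36 ∷ 39 ∷ 17 ∷ []) ∷
  (2 ∷ 26 ∷ 35 ∷ 41 ∷ []) ∷ (2 ∷ 40 ∷ 43 ∷ 37 ∷ []) ∷ (8 ∷ 21 ∷ 35 ∷ 43 ∷ []) ∷ (8 ∷ 20 ∷ 41 ∷ 37 ∷ []) ∷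
  (11 ∷ 26 ∷ 43 ∷ 20 ∷ []) ∷ (11 ∷ 40 ∷ 21 ∷ 41 ∷ []) ∷ (13 ∷ 26 ∷ 21 ∷ 37 ∷ []) ∷ (13 ∷ 40 ∷ 35 ∷ 20 ∷ []) ∷
  (3 ∷ 32 ∷ 48 ∷ 46 ∷ []) ∷ (3 ∷ 18 ∷ 42 ∷ 31 ∷ []) ∷ (5 ∷ 24 ∷ 48 ∷ 42 ∷ []) ∷ (5 ∷ 28 ∷ 46 ∷ 31 ∷ []) ∷
  (10 ∷ 32 ∷ 42 ∷ 28 ∷ []) ∷ (10 ∷ 18 ∷ 24 ∷ 46 ∷ []) ∷ (16 ∷ 32 ∷ 24 ∷ 31 ∷ []) ∷ (16 ∷ 18 ∷ 48 ∷ 28 ∷ []) ∷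
  (4 ∷ 25 ∷ 33 ∷ 38 ∷ []) ∷ (4 ∷ 22 ∷ 45 ∷ 44 ∷ []) ∷ (6 ∷ 23 ∷ 33 ∷ 45 ∷ []) ∷ (6 ∷ 27 ∷ 38 ∷ 44 ∷ []) ∷
  (9 ∷ 25 ∷ 45 ∷ 27 ∷ []) ∷ (9 ∷ 22 ∷ 23 ∷ 38 ∷ []) ∷ (15 ∷ 25 ∷ 23 ∷ 44 ∷ []) ∷ (15 ∷ 22 ∷ 33 ∷ 27 ∷ []) ∷
  (1 ∷ 26 ∷ 48 ∷ 38 ∷ []) ∷ (1 ∷ 40 ∷ 45 ∷ 31 ∷ []) ∷ (8 ∷ 19 ∷ 48 ∷ 45 ∷ []) ∷ (8 ∷ 17 ∷ 38 ∷ 31 ∷ []) ∷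
  (10 ∷ 26 ∷ 45 ∷ 17 ∷ []) ∷ (10 ∷ 40 ∷ 19 ∷ 38 ∷ []) ∷ (15 ∷ 26 ∷ 19 ∷ 31 ∷ []) ∷ (15 ∷ 40 ∷ 48 ∷ 17 ∷ []) ∷
  (2 ∷ 29 ∷ 33 ∷ 46 ∷ []) ∷ (2 ∷ 36 ∷ 42 ∷ 44 ∷ []) ∷ (7 ∷ 21 ∷ 33 ∷ 42 ∷ []) ∷ (7 ∷ 20 ∷ 46 ∷ 44 ∷ []) ∷
  (9 ∷ 29 ∷ 42 ∷ 20 ∷ []) ∷ (9 ∷ 36 ∷ 21 ∷ 46 ∷ []) ∷ (16 ∷ 29 ∷ 21 ∷ 44 ∷ []) ∷ (16 ∷ 36 ∷ 33 ∷ 20 ∷ []) ∷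
  (3 ∷ 25 ∷ 39 ∷ 41 ∷ []) ∷ (3 ∷ 22 ∷ 43 ∷ 30 ∷ []) ∷ (6 ∷ 24 ∷ 39 ∷ 43 ∷ []) ∷ (6 ∷ 28 ∷ 41 ∷ 30 ∷ []) ∷
  (12 ∷ 25 ∷ 43 ∷ 28 ∷ []) ∷ (12 ∷ 22 ∷ 24 ∷ 41 ∷ []) ∷ (13 ∷ 25 ∷ 24 ∷ 30 ∷ []) ∷ (13 ∷ 22 ∷ 39 ∷ 28 ∷ []) ∷
  (4 ∷ 32 ∷ 35 ∷ 47 ∷ []) ∷ (4 ∷ 18 ∷ 34 ∷ 37 ∷ []) ∷ (5 ∷ 23 ∷ 35 ∷ 34 ∷ []) ∷ (5 ∷ 27 ∷ 47 ∷ 37 ∷ []) ∷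
  (11 ∷ 32 ∷ 34 ∷ 27 ∷ []) ∷ (11 ∷ 18 ∷ 23 ∷ 47 ∷ []) ∷ (14 ∷ 32 ∷ 23 ∷ 37 ∷ []) ∷ (14 ∷ 18 ∷ 35 ∷ 27 ∷ []) ∷
  (1 ∷ 21 ∷ 24 ∷ 27 ∷ []) ∷ (1 ∷ 20 ∷ 23 ∷ 28 ∷ []) ∷ (2 ∷ 19 ∷ 24 ∷ 23 ∷ []) ∷ (2 ∷ 17 ∷ 27 ∷ 28 ∷ []) ∷
  (3 ∷ 21 ∷ 23 ∷ 17 ∷ []) ∷ (3 ∷ 20 ∷ 19 ∷ 27 ∷ []) ∷ (4 ∷ 21 ∷ 19 ∷ 28 ∷ []) ∷ (4 ∷ 20 ∷ 24 ∷ 17 ∷ []) ∷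
  (5 ∷ 25 ∷ 29 ∷ 40 ∷ []) ∷ (5 ∷ 22 ∷ 26 ∷ 36 ∷ []) ∷ (6 ∷ 32 ∷ 29 ∷ 26 ∷ []) ∷ (6 ∷ 18 ∷ 40 ∷ 36 ∷ []) ∷
  (7 ∷ 25 ∷ 26 ∷ 18 ∷ []) ∷ (7 ∷ 22 ∷ 32 ∷ 40 ∷ []) ∷ (8 ∷ 25 ∷ 32 ∷ 36 ∷ []) ∷ (8 ∷ 22 ∷ 29 ∷ 18 ∷ []) ∷
  (9 ∷ 48 ∷ 35 ∷ 30 ∷ []) ∷ (9 ∷ 31 ∷ 39 ∷ 37 ∷ []) ∷ (10 ∷ 33 ∷ 35 ∷ 39 ∷ []) ∷ (10 ∷ 44 ∷ 30 ∷ 37 ∷ []) ∷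
  (11 ∷ 48 ∷ 39 ∷ 44 ∷ []) ∷ (11 ∷ 31 ∷ 33 ∷ 30 ∷ []) ∷ (12 ∷ 48 ∷ 33 ∷ 37 ∷ []) ∷ (12 ∷ 31 ∷ 35 ∷ 44 ∷ []) ∷
  (13 ∷ 34 ∷ 45 ∷ 46 ∷ []) ∷ (13 ∷ 47 ∷ 42 ∷ 38 ∷ []) ∷ (14 ∷ 43 ∷ 45 ∷ 42 ∷ []) ∷ (14 ∷ 41 ∷ 46 ∷ 38 ∷ []) ∷
  (15 ∷ 34 ∷ 42 ∷ 41 ∷ []) ∷ (15 ∷ 47 ∷ 43 ∷ 46 ∷ []) ∷ (16 ∷ 34 ∷ 43 ∷ 38 ∷ []) ∷ (16 ∷ 47 ∷ 45 ∷ 41 ∷ []) ∷ []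

-- Small transversal designs

-- The rows are the multiples by 0, 1, ω, ω² in F₄, coded as 0, 1, 2, 3. Likewise `td5` and `td7`
-- use the multiples by 0, 1, 2, 3, `td8` those by 0, 1, α, α + 1 with α³ = α + 1, and `td9` those
-- by 0, 1, -1, i with i² = -1.
td4 : TD 4 4
td4 = Difference.td 4 (2 ∷ 2 ∷ [])
    ((0 ∷ 0 ∷ 0 ∷ 0 ∷ []) ∷
     (0 ∷ 1 ∷ 2 ∷ 3 ∷ []) ∷
     (0 ∷ 2 ∷ 3 ∷ 1 ∷ []) ∷
     (0 ∷ 3 ∷ 1 ∷ 2 ∷ []) ∷ []) refl refl refl

td5 : TD 4 5
td5 = Difference.td 5 (5 ∷ [])
    ((0 ∷ 0 ∷ 0 ∷ 0 ∷ 0 ∷ []) ∷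
     (0 ∷ 1 ∷ 2 ∷ 3 ∷ 4 ∷ []) ∷
     (0 ∷ 2 ∷ 4 ∷ 1 ∷ 3 ∷ []) ∷
     (0 ∷ 3 ∷ 1 ∷ 4 ∷ 2 ∷ []) ∷ []) refl refl refl

td7 : TD 4 7
td7 = Difference.td 7 (7 ∷ [])
    ((0 ∷ 0 ∷ 0 ∷ 0 ∷ 0 ∷ 0 ∷ 0 ∷ []) ∷
     (0 ∷ 1 ∷ 2 ∷ 3 ∷ 4 ∷ 5 ∷ 6 ∷ []) ∷
     (0 ∷ 2 ∷ 4 ∷ 6 ∷ 1 ∷ 3 ∷ 5 ∷ []) ∷
     (0 ∷ 3 ∷ 6 ∷ 2 ∷ 5 ∷ 1 ∷ 4 ∷ []) ∷ []) refl refl refl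

td8 : TD 4 8
td8 = Difference.td 8 (2 ∷ 2 ∷ 2 ∷ [])
    ((0 ∷ 0 ∷ 0 ∷ 0 ∷ 0 ∷ 0 ∷ 0 ∷ 0 ∷ []) ∷
     (0 ∷ 1 ∷ 2 ∷ 3 ∷ 4 ∷ 5 ∷ 6 ∷ 7 ∷ []) ∷
     (0 ∷ 2 ∷ 4 ∷ 6 ∷ 3 ∷ 1 ∷ 7 ∷ 5 ∷ []) ∷
     (0 ∷ 3 ∷ 6 ∷ 5 ∷ 7 ∷ 4 ∷ 1 ∷ 2 ∷ []) ∷ []) refl refl refl

td9 : TD 4 9
td9 = Difference.td 9 (3 ∷ 3 ∷ [])
    ((0 ∷ 0 ∷ 0 ∷ 0 ∷ 0 ∷ 0 ∷ 0 ∷ 0 ∷ 0 ∷ []) ∷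
     (0 ∷ 1 ∷ 2 ∷ 3 ∷ 4 ∷ 5 ∷ 6 ∷ 7 ∷ 8 ∷ []) ∷
     (0 ∷ 2 ∷ 1 ∷ 6 ∷ 8 ∷ 7 ∷ 3 ∷ 5 ∷ 4 ∷ []) ∷
     (0 ∷ 3 ∷ 6 ∷ 2 ∷ 5 ∷ 8 ∷ 1 ∷ 4 ∷ 7 ∷ []) ∷ []) refl refl refl

-- There is no field of order 12, so these rows over Z₂ × Z₂ × Z₃ are not multiples in a field. The
-- order is wanted for x = 12 in `low`, which is too far from 9.
td12 : TD 4 12
td12 = Difference.td 12 (2 ∷ 2 ∷ 3 ∷ [])
    ((0 ∷ 0 ∷ 0 ∷ 0 ∷ 0 ∷ 0 ∷ 0 ∷ 0 ∷ 0 ∷ 0 ∷ 0 ∷ 0 ∷ []) ∷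
     (0 ∷ 1 ∷ 2 ∷ 3 ∷ 4 ∷ 5 ∷ 6 ∷ 7 ∷ 8 ∷ 9 ∷ 10 ∷ 11 ∷ []) ∷
     (0 ∷ 2 ∷ 3 ∷ 4 ∷ 1 ∷ 8 ∷ 10 ∷ 9 ∷ 6 ∷ 11 ∷ 5 ∷ 7 ∷ []) ∷
     (0 ∷ 9 ∷ 4 ∷ 2 ∷ 7 ∷ 10 ∷ 11 ∷ 1 ∷ 5 ∷ 6 ∷ 8 ∷ 3 ∷ []) ∷ []) refl refl refl

td13 : TD 4 13
td13 = Difference.td 13 (13 ∷ [])
    ((0 ∷ 0 ∷ 0 ∷ 0 ∷ 0 ∷ 0 ∷ 0 ∷ 0 ∷ 0 ∷ 0 ∷ 0 ∷ 0 ∷ 0 ∷ []) ∷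
     (0 ∷ 1 ∷ 2 ∷ 3 ∷ 4 ∷ 5 ∷ 6 ∷ 7 ∷ 8 ∷ 9 ∷ 10 ∷ 11 ∷ 12 ∷ []) ∷
     (0 ∷ 2 ∷ 1 ∷ 5 ∷ 7 ∷ 10 ∷ 12 ∷ 11 ∷ 3 ∷ 6 ∷ 4 ∷ 9 ∷ 8 ∷ []) ∷
     (0 ∷ 3 ∷ 10 ∷ 12 ∷ 11 ∷ 9 ∷ 7 ∷ 4 ∷ 6 ∷ 8 ∷ 2 ∷ 1 ∷ 5 ∷ []) ∷ []) refl refl refl

mols3 : TD 3 3
mols3 = Difference.td 3 (3 ∷ [])
    ((0 ∷ 0 ∷ 0 ∷ []) ∷
     (0 ∷ 1 ∷ 2 ∷ []) ∷
     (0 ∷ 2 ∷ 1 ∷ []) ∷ []) refl refl refl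

-- The rows are 0, x and ω²x + 1 over F₄. A block is monochromatic when its column is constant;
-- without the translation by 1 the column of x = 0 would be.
mols4 : TD 3 4
mols4 = Difference.td 4 (2 ∷ 2 ∷ [])
    ((0 ∷ 0 ∷ 0 ∷ 0 ∷ []) ∷
     (0 ∷ 1 ∷ 2 ∷ 3 ∷ []) ∷
     (1 ∷ 2 ∷ 0 ∷ 3 ∷ []) ∷ []) refl refl refl


-- Frames with few holes

K₄ : Frame {Fin 4} _≢_
K₄ = frame 4 kts9Blocks refl refl refl

K₇ : Frame {Fin 7} _≢_
K₇ = frame 7 kts15Blocks refl refl refl

fromGDD : ∀ k {{_ : NonZero (k * 3)}} {b} (blocks : Vec (Vec ℕ 4) b) → let open Finite (k * 3) (apart k 3) blocks in
          joined ≡ true → located ≡ true → Uniform 3 (Fin k)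
fromGDD k blocks hj hl = decompose (compose (ungroup k 3) (λ _ → finite hj hl)) (λ _ → K₄)
  where open Finite (k * 3) (apart k 3) blocks

K₁₃ : Frame {Fin 13} _≢_
K₁₃ = decompose (compose (iso id id (λ _ → refl) (λ _ → refl) ≢-intro ≢-elim) (λ _ → finite refl refl)) (λ _ → K₄)
  where open Finite 13 (λ x y → not (x == y)) plane13Blocks

U₄ : Uniform 3 (Fin 4)
U₄ = inflate mols3 K₄

U₅ : Uniform 3 (Fin 5)
U₅ = fromGDD 5 gdd5Blocks refl refl

U₇ : Uniform 3 (Fin 7)
U₇ = inflate mols3 K₇

U₈ : Uniform 3 (Fin 8)
U₈ = fromGDD 8 gdd8Blocks refl refl

U₉ : Uniform 3 (Fin 9)
U₉ = fromGDD 9 gdd9Blocks refl refl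

U₁₂ : Uniform 3 (Fin 12)
U₁₂ = fromGDD 12 gdd12Blocks refl refl

U₁₃ : Uniform 3 (Fin 13)
U₁₃ = inflate mols3 K₁₃

empty : {O : Set} {isC : O → Bool} {_~_ : Rel O} → (∀ x y → ¬ (x ~ y)) → Resolved isC _~_
empty h = record
  { Block  = ⊥
  ; obj    = λ ()
  ; covers = record { hom = λ { {()} } ; cover = λ {x} {y} r → ⊥-elim (h x y r) ; unique = λ { {()} } }
  ; kind   = λ ()
  }

-- For d = 0 the truncated group has at most one point, so the recursion meets frames with no hole
-- or a single one. There are no pairs across holes to cover.
U₀ : Uniform 3 (Fin 0)
U₀ = empty λ { ((() , _) , _) }

U₁ : Uniform 3 (Fin 1)
U₁ = empty λ { ((zero , _) , _) ((zero , _) , _) ((n , _) , _) → n refl }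

-- Frames with r holes of size 6, for r ≡ 0 or 1 (mod 4)

largest : {a : Level} {P : ℕ → Set a} → ℕ → Σ ℕ P → List (Σ ℕ P) → Σ ℕ P
largest x c []       = c
largest x c (d ∷ ds) = if proj₁ d ≤ᵇ x then largest x d ds else c

fits : ℕ → ℕ → ℕ → Bool
fits c m x = (m ≤ᵇ x) ∧ (4 * (x ∸ m) + c ≤ᵇ m)

≤ᵇ-sound : ∀ {m n} → (m ≤ᵇ n) ≡ true → m ≤ n
≤ᵇ-sound {m} {n} h = ≤ᵇ⇒≤ m n (subst T (sym h) _)

fits-sound : ∀ {c m x} → fits c m x ≡ true → ∃[ d ] m + d ≡ x × 4 * d + c ≤ m
fits-sound {c} {m} {x} h = let (h₁ , h₂) = ∧-true {m ≤ᵇ x} h in x ∸ m , m+[n∸m]≡n (≤ᵇ-sound {m} h₁) , ≤ᵇ-sound h₂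

-- Truncation to 4 d + e points with e ≤ 1 asks only for 4 d + 1 ≤ m. The constant 4 is the least c
-- for which the bound persists when x is replaced by 4 x + 3 and m by 4 m: this needs 12 + c ≤ 4 c.
-- The residue is recorded because a frame with m holes is itself obtained by the recursion.
record Near (x : ℕ) : Set where
  constructor near
  field
    {m d}    : ℕ
    sum      : m + d ≡ x
    close    : 4 * d + 4 ≤ m
    residue  : m % 4 ≤ 1
    design   : TD 4 m

-- If m is near x then 4 m is near 4 x + e for e < 4, so it suffices to treat 16 ≤ x < 64.
medium : ℕ → Σ ℕ (TD 4)
medium x = largest x (16 , productTD td4 td4)
  ((20 , productTD td4 td5) ∷ (25 , productTD td5 td5) ∷ (28 , productTD td4 td7) ∷ (32 , productTD td4 td8) ∷
   (36 , productTD td4 td9) ∷ (45 , productTD td5 td9) ∷ (52 , productTD td4 td13) ∷ [])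

mediumCheck : Fin 48 → Bool
mediumCheck i = let x = 16 + toℕ i ; m = proj₁ (medium x) in fits 4 m x ∧ (m % 4 ≤ᵇ 1)

nearest : ∀ x → 16 ≤ x → Near x
nearest = <-rec (λ x → 16 ≤ x → Near x) go
  where
  go : ∀ x → (∀ {y} → y < x → 16 ≤ y → Near y) → 16 ≤ x → Near x
  go x ih 16≤x with x <? 64
  ... | yes x<64 = subst Near x≡ (small (fromℕ< x∸16<48))
    where
    x∸16<48 : x ∸ 16 < 48
    x∸16<48 = ∸-monoˡ-< x<64 16≤x
    x≡ : 16 + toℕ (fromℕ< x∸16<48) ≡ x
    x≡ = trans (cong (16 +_) (toℕ-fromℕ< x∸16<48)) (m+[n∸m]≡n 16≤x)
    small : (i : Fin 48) → Near (16 + toℕ i)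
    small i = let (h , h′) = ∧-true {fits 4 (proj₁ (medium (16 + toℕ i))) (16 + toℕ i)} (allF-sound {f = mediumCheck} refl i)
                  (d , e , c) = fits-sound {4} {proj₁ (medium (16 + toℕ i))} h
              in near e c (≤ᵇ-sound h′) (proj₂ (medium (16 + toℕ i)))
  ... | no x≮64 = widen (ih x/4<x (/-monoˡ-≤ 4 (≮⇒≥ x≮64)))
    where
    x/4<x : x / 4 < x
    x/4<x = m/n<m x 4 {{>-nonZero (≤-trans (s≤s z≤n) 16≤x)}} (s≤s (s≤s z≤n))
    widen : Near (x / 4) → Near x
    widen (near {m} {d} sum close _ design) = near {d = 4 * d + x % 4}
      (trans (rearrange m d (x % 4)) (trans (cong (λ y → x % 4 + y * 4) sum) (sym (m≡m%n+[m/n]*n x 4))))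
      (begin
        4 * (4 * d + x % 4) + 4 ≤⟨ +-monoˡ-≤ 4 (*-monoʳ-≤ 4 (+-monoʳ-≤ (4 * d) (≤-pred (m%n<n x 4)))) ⟩
        4 * (4 * d + 3) + 4     ≡⟨ regroup d ⟩
        4 * (4 * d + 4)         ≤⟨ *-monoʳ-≤ 4 close ⟩
        4 * m                   ∎)
      (≤-reflexive′ (trans (cong (_% 4) (*-comm 4 m)) (m*n%n≡0 m 4)))
      (productTD td4 design)
      where
      open ≤-Reasoning
      rearrange : ∀ m d e → 4 * m + (4 * d + e) ≡ e + (m + d) * 4
      rearrange = solve-∀
      regroup : ∀ d → 4 * (4 * d + 3) + 4 ≡ 4 * (4 * d + 4)
      regroup = solve-∀
      ≤-reflexive′ : ∀ {a} → a ≡ 0 → a ≤ 1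
      ≤-reflexive′ refl = z≤n

-- The truncated group has t = e + 4 d points, so 4 m + t = e + 4 (m + d); `close` together with e ≤
-- 1 gives t ≤ m.
extend : ∀ {m d e} → e ≤ 1 → 4 * d + 1 ≤ m → TD 4 m → Uniform 3 (Fin m) → Uniform 3 (Fin (e + d * 4)) →
         Uniform 3 (Fin (e + (m + d) * 4))
extend {m} {d} {e} e≤1 close D Uₘ Uₜ = subst (λ n → Uniform 3 (Fin n)) eq
  (step (subst (TD 4) (sym m≡) D) U₄ U₅ (subst (λ n → Uniform 3 (Fin n)) (sym m≡) Uₘ) Uₜ)
  where
  t≤m : e + d * 4 ≤ m
  t≤m = begin
    e + d * 4 ≤⟨ +-monoˡ-≤ (d * 4) e≤1 ⟩
    1 + d * 4 ≡⟨ trans (+-comm 1 (d * 4)) (cong (_+ 1) (*-comm d 4)) ⟩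
    4 * d + 1 ≤⟨ close ⟩
    m         ∎
    where open ≤-Reasoning
  m≡ : (e + d * 4) + (m ∸ (e + d * 4)) ≡ m
  m≡ = m+[n∸m]≡n t≤m
  eq : 4 * ((e + d * 4) + (m ∸ (e + d * 4))) + (e + d * 4) ≡ e + (m + d) * 4
  eq = trans (cong (λ n → 4 * n + (e + d * 4)) m≡) (rearrange m d e)
    where
    rearrange : ∀ m d e → 4 * m + (e + d * 4) ≡ e + (m + d) * 4
    rearrange = solve-∀

-- Although 7 is 3 modulo 4, it is needed at x = 7, that is for r = 28 and 29, which is too far from
-- 5. Its frame comes from the punctured KTS(15).
low : ℕ → Σ ℕ (λ m → TD 4 m × Uniform 3 (Fin m))
low x = largest x (4 , td4 , U₄)
  ((5 , td5 , U₅) ∷ (7 , td7 , U₇) ∷ (8 , td8 , U₈) ∷ (9 , td9 , U₉) ∷ (12 , td12 , U₁₂) ∷ (13 , td13 , U₁₃) ∷ [])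

lowCheck : Fin 12 → Bool
lowCheck i = fits 1 (proj₁ (low (4 + toℕ i))) (4 + toℕ i)

uniform₃ : ∀ r → r % 4 ≤ 1 → Uniform 3 (Fin r)
uniform₃ r h = subst (λ n → Uniform 3 (Fin n)) (sym (m≡m%n+[m/n]*n r 4)) (<-rec P go (r / 4) (r % 4) h)
  where
  P : ℕ → Set₁
  P x = ∀ e → e ≤ 1 → Uniform 3 (Fin (e + x * 4))
  go : ∀ x → (∀ {y} → y < x → P y) → P x
  go 0 _ 0 _ = U₀
  go 0 _ 1 _ = U₁
  go 1 _ 0 _ = U₄
  go 1 _ 1 _ = U₅
  go 2 _ 0 _ = U₈
  go 2 _ 1 _ = U₉
  go 3 _ 0 _ = U₁₂
  go 3 _ 1 _ = U₁₃
  go 0 _ (suc (suc _)) (s≤s ())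
  go 1 _ (suc (suc _)) (s≤s ())
  go 2 _ (suc (suc _)) (s≤s ())
  go 3 _ (suc (suc _)) (s≤s ())
  go x@(suc (suc (suc (suc y)))) ih e e≤1 with x <? 16
  ... | yes x<16 = subst (λ x → Uniform 3 (Fin (e + x * 4))) eq (extend e≤1 close (proj₁ (proj₂ l)) (proj₂ (proj₂ l)) (ih d<x e e≤1))
    where
    y<12 : y < 12
    y<12 = ≤-pred (≤-pred (≤-pred (≤-pred x<16)))
    l = low x
    y≡ : toℕ (fromℕ< y<12) ≡ y
    y≡ = toℕ-fromℕ< y<12
    fit : ∃[ d ] proj₁ l + d ≡ x × 4 * d + 1 ≤ proj₁ l
    fit = fits-sound {1} {proj₁ l} (subst (λ y → fits 1 (proj₁ (low (4 + y))) (4 + y) ≡ true) y≡ (allF-sound {f = lowCheck} refl (fromℕ< y<12)))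
    d = proj₁ fit
    eq = proj₁ (proj₂ fit)
    close = proj₂ (proj₂ fit)
    d<x : d < x
    d<x = subst (d <_) eq (m<n+m d (≤-trans (m≤n+m 1 (4 * d)) close))
  ... | no x≮16 with nearest x (≮⇒≥ x≮16)
  ... | near {m} {d} sum close residue D =
    subst (λ x → Uniform 3 (Fin (e + x * 4))) sum
      (extend e≤1 (≤-trans (+-monoʳ-≤ (4 * d) (s≤s z≤n)) close) D
        -- The full groups need a frame with m holes; `residue` makes this the instance m / 4 of the
        -- induction.
        (subst (λ n → Uniform 3 (Fin n)) (sym (m≡m%n+[m/n]*n m 4)) (ih m/4<x (m % 4) residue))
        (ih d<x e e≤1))
    where
    m>0 : 0 < m
    m>0 = ≤-trans (s≤s z≤n) (≤-trans (m≤n+m 4 (4 * d)) close)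
    d<x : d < x
    d<x = subst (d <_) sum (m<n+m d m>0)
    m/4<x : m / 4 < x
    m/4<x = <-≤-trans (m/n<m m 4 {{>-nonZero m>0}} (s≤s (s≤s z≤n))) (subst (m ≤_) sum (m≤m+n m d))

-- Exhaustive search for 3-colourings

Domain : Set
Domain = Vec Bool 3

Cell : Set
Cell = ℕ × Domain

size : Domain → ℕ
size (a ∷ b ∷ c ∷ []) = bit a + (bit b + bit c)
  where
  bit : Bool → ℕ
  bit true  = 1
  bit false = 0

least : List Cell → ℕ
least []             = 3
least ((_ , D) ∷ cs) = size D ⊓ least cs

extract : ℕ → List Cell → Maybe (Cell × List Cell)
push : Cell → Maybe (Cell × List Cell) → Maybe (Cell × List Cell)
extract s []       = nothing
extract s (c ∷ cs) = if size (proj₂ c) ≤ᵇ s then just (c , cs) else push c (extract s cs)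
push c nothing         = nothing
push c (just (d , cs)) = just (d , c ∷ cs)

strike : Fin 3 → ℕ → List Cell → List Cell
strike k z []             = []
strike k z ((x , D) ∷ cs) = if x ≡ᵇ z then (x , D [ k ]≔ false) ∷ cs else (x , D) ∷ strike k z cs

Row : Set
Row = List (ℕ × ℕ)

third : Row → ℕ → Maybe ℕ
third []             y = nothing
third ((p , q) ∷ ps) y = if p ≡ᵇ y then just q else third ps y

strikeAt : Fin 3 → Maybe ℕ → List Cell → List Cell
strikeAt k nothing  cs = cs
strikeAt k (just z) cs = strike k z cs

-- A new point and an earlier point of the same colour forbid that colour to the third point of
-- their triple. Points already coloured have left the list of cells, so striking them changes
-- nothing.
strikes : Row → Fin 3 → List ℕ → List Cell → List Cell
strikes row k []       cs = cs
strikes row k (y ∷ ys) cs = strikes row k ys (strikeAt k (third row y) cs)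

rowAt : List Row → ℕ → Row
rowAt []       _       = []
rowAt (r ∷ _)  zero    = r
rowAt (_ ∷ rs) (suc n) = rowAt rs n

Classes : Set
Classes = Vec (List ℕ) 3

-- Branches on the earliest cell with a smallest domain, so that forced colours come first; an empty domain leaves no
-- cases and closes the branch.
refute   : ℕ → List Row → Classes → List Cell → Bool
explore : ℕ → List Row → Classes → Maybe (Cell × List Cell) → Bool
branchAt : ℕ → List Row → Classes → Cell → List Cell → Fin 3 → Bool
refute zero    rows K cs = false
refute (suc n) rows K cs = explore n rows K (extract (least cs) cs)
explore n rows K nothing         = false
explore n rows K (just (c , cs)) = allF (branchAt n rows K c cs)
branchAt n rows K (x , D) cs k =
  lookup D k ⇒ refute n rows (K [ k ]≔ (x ∷ lookup K k)) (strikes (rowAt rows x) k (lookup K k) cs)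
CodeTriple : Set
CodeTriple = ℕ × ℕ × ℕ

row : List CodeTriple → ℕ → Row
row []                 x = []
row ((p , q , r) ∷ ts) x =
  if x ≡ᵇ p then (q , r) ∷ (r , q) ∷ row ts x else
  if x ≡ᵇ q then (p , r) ∷ (r , p) ∷ row ts x else
  if x ≡ᵇ r then (p , q) ∷ (q , p) ∷ row ts x else row ts x

module _ (f : ℕ → Fin 3) where

  Mixed : CodeTriple → Set
  Mixed (x , y , z) = ¬ (f x ≡ f y × f y ≡ f z)

  Allowed : Cell → Set
  Allowed (x , D) = lookup D (f x) ≡ true

  extract-sound : ∀ s cs {c rest} → All Allowed cs → extract s cs ≡ just (c , rest) → Allowed c × All Allowed rest
  extract-sound s (c ∷ cs) (a ∷ as) h with size (proj₂ c) ≤ᵇ s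
  extract-sound s (c ∷ cs) (a ∷ as) refl | true = a , as
  extract-sound s (c ∷ cs) (a ∷ as) h    | false with extract s cs in eq
  extract-sound s (c ∷ cs) (a ∷ as) refl | false | just _ =
    let (b , bs) = extract-sound s cs as eq in b , a ∷ bs

  strike-sound : ∀ k z cs → f z ≢ k → All Allowed cs → All Allowed (strike k z cs)
  strike-sound k z []             n []       = []
  strike-sound k z ((x , D) ∷ cs) n (a ∷ as) with x ≡ᵇ z in eq
  ... | false = a ∷ strike-sound k z cs n as
  ... | true with refl ← ≡ᵇ⇒≡ x z (subst T (sym eq) _) = trans (lookup∘update′ n D false) a ∷ as

  third-sound : ∀ x ps y {z} → All (λ (y , z) → Mixed (x , y , z)) ps → third ps y ≡ just z → Mixed (x , y , z)
  third-sound x ((p , q) ∷ ps) y (m ∷ ms) h with p ≡ᵇ y in eq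
  third-sound x ((p , q) ∷ ps) y (m ∷ ms) refl | true with refl ← ≡ᵇ⇒≡ p y (subst T (sym eq) _) = m
  third-sound x ((p , q) ∷ ps) y (m ∷ ms) h    | false = third-sound x ps y ms h

  strikes-sound : ∀ x ps ys cs → All (λ (y , z) → Mixed (x , y , z)) ps → All (λ y → f y ≡ f x) ys →
                  All Allowed cs → All Allowed (strikes ps (f x) ys cs)
  strikes-sound x ps []       cs ms []       as = as
  strikes-sound x ps (y ∷ ys) cs ms (e ∷ es) as = strikes-sound x ps ys _ ms es (strikeAt-sound (third ps y) refl)
    where
    strikeAt-sound : ∀ r → third ps y ≡ r → All Allowed (strikeAt (f x) r cs)
    strikeAt-sound nothing  _ = as
    strikeAt-sound (just z) h =
      strike-sound (f x) z cs (λ e′ → third-sound x ps y ms h (sym e , trans e (sym e′))) as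

  -- A colouring `f` singles out the branch `f x` at every node. Striking never removes the value of
  -- `f` from a domain, so this branch is always among the cases, and it can end only by running out
  -- of fuel or of cells; both return `false`.
  refute-sound : ∀ n rows → (∀ x → All (λ (y , z) → Mixed (x , y , z)) (rowAt rows x)) →
                 ∀ K cs → (∀ k → All (λ y → f y ≡ k) (lookup K k)) → All Allowed cs → refute n rows K cs ≢ true
  refute-sound (suc n) rows ms K cs ks as h with extract (least cs) cs in eq
  ... | just ((x , D) , rest) =
    let (a , bs) = extract-sound (least cs) cs as eq
    in refute-sound n rows ms _ _ classes-sound (strikes-sound x _ _ rest (ms x) (ks (f x)) bs)
         (⇒-elim (allF-sound {f = branchAt n rows K (x , D) rest} h (f x)) a)
    where
    classes-sound : ∀ k → All (λ y → f y ≡ k) (lookup (K [ f x ]≔ (x ∷ lookup K (f x))) k)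
    classes-sound k with k ≟ᶠ f x
    ... | yes refl = subst (All _) (sym (lookup∘update (f x) K _)) (refl ∷ ks (f x))
    ... | no  k≢fx = subst (All _) (sym (lookup∘update′ k≢fx K _)) (ks k)

  row-sound : ∀ ts x → All Mixed ts → All (λ (y , z) → Mixed (x , y , z)) (row ts x)
  row-sound []                 x []       = []
  row-sound ((p , q , r) ∷ ts) x (m ∷ ms) with x ≡ᵇ p in eqp
  ... | true with refl ← ≡ᵇ⇒≡ x p (subst T (sym eqp) _) =
    m ∷ (λ (e , e′) → m (trans e e′ , sym e′)) ∷ row-sound ts x ms
  ... | false with x ≡ᵇ q in eqq
  ... | true with refl ← ≡ᵇ⇒≡ x q (subst T (sym eqq) _) =
    (λ (e , e′) → m (sym e , trans e e′)) ∷ (λ (e , e′) → m (sym (trans e e′) , e)) ∷ row-sound ts x ms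
  ... | false with x ≡ᵇ r in eqr
  ... | true with refl ← ≡ᵇ⇒≡ x r (subst T (sym eqr) _) =
    (λ (e , e′) → m (e′ , sym (trans e e′))) ∷ (λ (e , e′) → m (sym e′ , sym e)) ∷ row-sound ts x ms
  ... | false = row-sound ts x ms

rowAt-elim : ∀ {P : ℕ → Row → Set} g n → (∀ x → P x (g x)) → (∀ x → P x []) → ∀ x → P x (rowAt (applyUpTo g n) x)
rowAt-elim g zero    p p₀ x       = p₀ x
rowAt-elim g (suc n) p p₀ zero    = p zero
rowAt-elim {P} g (suc n) p p₀ (suc x) = rowAt-elim {P ∘ suc} (g ∘ suc) n (p ∘ suc) (p₀ ∘ suc) x

triplePart : Vec ℕ 4 → CodeTriple
triplePart (_ ∷ a ∷ b ∷ c ∷ []) = a , b , c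

kts33Triples : List CodeTriple
kts33Triples = map triplePart (toList kts33Blocks)

anyColour : Domain
anyColour = true ∷ true ∷ true ∷ []

-- The colour of ∞ may be fixed by symmetry; the order of the other points was chosen to keep the search tree small.
cells : List Cell
cells = (0 , true ∷ false ∷ false ∷ []) ∷ map (_, anyColour)
  (25 ∷ 26 ∷ 45 ∷ 41 ∷ 46 ∷ 48 ∷ 43 ∷ 30 ∷ 24 ∷ 23 ∷ 29 ∷ 34 ∷ 20 ∷ 18 ∷ 37 ∷ 19 ∷
   21 ∷ 36 ∷ 47 ∷ 44 ∷ 22 ∷ 33 ∷ 42 ∷ 32 ∷ 17 ∷ 39 ∷ 27 ∷ 28 ∷ 35 ∷ 38 ∷ 40 ∷ 31 ∷ [])

refutation : ∀ n N ts cs → refute n (applyUpTo (row ts) N) (replicate 3 []) cs ≡ true →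
             ∀ f → All (Mixed f) ts → ¬ All (Allowed f) cs
refutation n N ts cs h f ms as = refute-sound f n (applyUpTo (row ts) N)
  (rowAt-elim {λ x r → All (λ (y , z) → Mixed f (x , y , z)) r} (row ts) N (λ x → row-sound f ts x ms) (λ _ → []))
  (replicate 3 []) cs (λ k → subst (All _) (sym (lookup-replicate k [])) []) as h

notColourable₀ : (f : ℕ → Fin 3) → f 0 ≡ zero → ¬ All (Mixed f) kts33Triples
-- Every branching uses up one of the 33 cells, so fuel 34 suffices; the 49 rows serve the codes 0,
-- ..., 48.
notColourable₀ f f0 ms = refutation 34 49 kts33Triples cells refl f ms (at-zero f0 ∷ allowed-any _)
  where
  at-zero : ∀ {c} → c ≡ zero → lookup (true ∷ false ∷ false ∷ []) c ≡ true
  at-zero refl = refl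
  allowed-any : ∀ xs → All (Allowed f) (map (_, anyColour) xs)
  allowed-any []       = []
  allowed-any (x ∷ xs) = lookup-replicate {n = 3} (f x) true ∷ allowed-any xs

-- The transposition of `zero` and `a`. With the colour of ∞ for `a` it reduces an arbitrary
-- colouring to `notColourable₀`.
toZero : Fin 3 → Fin 3 → Fin 3
toZero a c = if c == a then zero else if c == zero then a else c

toZeroInjectiveAt : Fin 3 → Fin 3 → Fin 3 → Bool
toZeroInjectiveAt a b c = (toZero a b == toZero a c) ⇒ (b == c)

toZero-injective : ∀ a {b c} → toZero a b ≡ toZero a c → b ≡ c
toZero-injective a {b} {c} e = ==-sound (⇒-elim
  (allF-sound {f = toZeroInjectiveAt a b} (allF-sound {f = λ b → allF (toZeroInjectiveAt a b)}
    (allF-sound {f = λ a → allF λ b → allF (toZeroInjectiveAt a b)} refl a) b) c)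
  (trans (cong (toZero a b ==_) (sym e)) (==-refl (toZero a b))))

notColourable : (f : ℕ → Fin 3) → ¬ All (Mixed f) kts33Triples
notColourable f ms = notColourable₀ (toZero (f 0) ∘ f) (to0 (f 0))
  (All.map (λ m (e , e′) → m (toZero-injective (f 0) e , toZero-injective (f 0) e′)) ms)
  where
  to0 : ∀ a → toZero a a ≡ zero
  to0 a = cong (λ b → if b then zero else if a == zero then a else a) (==-refl a)

-- Counting in lists

count : {A : Set} → (A → Bool) → List A → ℕ
count p xs = length (filterᵇ p xs)

weight : Bool → ℕ
weight true  = 1
weight false = 0

count-∷ : {A : Set} (p : A → Bool) (x : A) (xs : List A) → count p (x ∷ xs) ≡ weight (p x) + count p xs
count-∷ p x xs with p x
... | true  = refl
... | false = refl

count-++ : {A : Set} (p : A → Bool) (xs ys : List A) → count p (xs ++ ys) ≡ count p xs + count p ys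
count-++ p []       ys = refl
count-++ p (x ∷ xs) ys = trans (count-∷ p x (xs ++ ys)) (trans (cong (weight (p x) +_) (count-++ p xs ys))
  (trans (sym (+-assoc (weight (p x)) _ _)) (cong (_+ count p ys) (sym (count-∷ p x xs)))))

count-zero : {A : Set} (p : A → Bool) (xs : List A) → (∀ x → p x ≢ true) → count p xs ≡ 0
count-zero p []       h = refl
count-zero p (x ∷ xs) h with p x in eq
... | true  = ⊥-elim (h x eq)
... | false = count-zero p xs h

count-map-filter : {A B : Set} (p : B → Bool) (g : A → B) (l : A → Bool) (xs : List A) →
                   count p (map g (filterᵇ l xs)) ≡ count (λ x → l x ∧ p (g x)) xs
count-map-filter p g l []       = refl
count-map-filter p g l (x ∷ xs) with l x
... | false = count-map-filter p g l xs
... | true  with p (g x)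
... | true  = cong suc (count-map-filter p g l xs)
... | false = count-map-filter p g l xs

count-one : ∀ {A : Set} {n} (p : A → Bool) (g : Fin n → A) (i : Fin n) → p (g i) ≡ true →
            (∀ j → p (g j) ≡ true → j ≡ i) → count p (tabulate g) ≡ 1
count-one p g zero    h u = trans (count-∷ p (g zero) _) (trans (cong (λ b → weight b + count p (tabulate (g ∘ suc))) h)
  (cong suc (none (tabulate (g ∘ suc)) (All.tabulate⁺ (λ j e → contra (u (suc j) e))))))
  where
  contra : ∀ {n} {j : Fin n} → Fin.suc j ≡ zero → ⊥
  contra ()
  none : ∀ xs → All (λ x → p x ≢ true) xs → count p xs ≡ 0
  none []       []       = refl
  none (x ∷ xs) (n ∷ ns) with p x
  ... | true  = ⊥-elim (n refl)
  ... | false = none xs ns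
count-one p g (suc i) h u = trans (count-∷ p (g zero) _) (cong₂ _+_ (absent (p (g zero)) refl)
  (count-one p (g ∘ suc) i h (λ j e → suc-injective (u (suc j) e))))
  where
  absent : ∀ b → p (g zero) ≡ b → weight b ≡ 0
  absent false _ = refl
  absent true  e with () ← u zero e

count-concat-one : {A B : Set} {n : ℕ} (p : B → Bool) (f : A → List B) (g : Fin n → A) (i : Fin n) →
                   count p (f (g i)) ≡ 1 → (∀ j → j ≢ i → count p (f (g j)) ≡ 0) →
                   count p (concat (map f (tabulate g))) ≡ 1
count-concat-zero : {A B : Set} {n : ℕ} (p : B → Bool) (f : A → List B) (g : Fin n → A) →
                    (∀ j → count p (f (g j)) ≡ 0) → count p (concat (map f (tabulate g))) ≡ 0
count-concat-zero {n = zero}  p f g z = refl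
count-concat-zero {n = suc n} p f g z =
  trans (count-++ p (f (g zero)) _) (cong₂ _+_ (z zero) (count-concat-zero p f (g ∘ suc) (z ∘ suc)))
count-concat-one p f g zero h z =
  trans (count-++ p (f (g zero)) _) (cong₂ _+_ h (count-concat-zero p f (g ∘ suc) (λ j → z (suc j) (λ ()))))
count-concat-one p f g (suc i) h z =
  trans (count-++ p (f (g zero)) _) (cong₂ _+_ (z zero (λ ()))
    (count-concat-one p f (g ∘ suc) i h (λ j n → z (suc j) (n ∘ suc-injective))))

countF : ∀ {n} → (Fin n → Bool) → ℕ
countF {zero}  p = 0
countF {suc n} p = weight (p zero) + countF (p ∘ suc)

count-tabulate : {A : Set} {n : ℕ} (p : A → Bool) (g : Fin n → A) → count p (tabulate g) ≡ countF (p ∘ g)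
count-tabulate {n = zero}  p g = refl
count-tabulate {n = suc n} p g = trans (count-∷ p (g zero) _) (cong (weight (p (g zero)) +_) (count-tabulate p (g ∘ suc)))

countF-+ : ∀ m n (p : Fin (m + n) → Bool) → countF p ≡ countF (λ i → p (i ↑ˡ n)) + countF (λ i → p (m ↑ʳ i))
countF-+ zero    n p = refl
countF-+ (suc m) n p = trans (cong (weight (p zero) +_) (countF-+ m n (p ∘ suc))) (sym (+-assoc (weight (p zero)) _ _))

countF-const : ∀ n b (p : Fin n → Bool) → (∀ i → p i ≡ b) → countF p ≡ weight b * n
countF-const zero    true  p h = refl
countF-const zero    false p h = refl
countF-const (suc n) true  p h rewrite h zero = cong suc (countF-const n true (p ∘ suc) (h ∘ suc))
countF-const (suc n) false p h rewrite h zero = countF-const n false (p ∘ suc) (h ∘ suc)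

countF-* : ∀ m n (p : Fin (m * n) → Bool) (q : Fin m → Bool) → (∀ i j → p (combine i j) ≡ q i) →
           countF p ≡ countF q * n
countF-* zero    n p q h = refl
countF-* (suc m) n p q h = trans (countF-+ n (m * n) p) (trans
  (cong₂ _+_ (countF-const n (q zero) _ (h zero)) (countF-* m n _ (q ∘ suc) (λ i j → h (suc i) j)))
  (sym (*-distribʳ-+ n (weight (q zero)) (countF (q ∘ suc)))))

countF-*+1 : ∀ m n (p : Fin (m * n + 1) → Bool) (q : Fin m → Bool) (b : Bool) →
             (∀ i j → p (combine i j ↑ˡ 1) ≡ q i) → p ((m * n) ↑ʳ zero) ≡ b → countF p ≡ countF q * n + weight b
countF-*+1 m n p q b h h₀ = trans (countF-+ (m * n) 1 p)
  (cong₂ _+_ (countF-* m n (λ i → p (i ↑ˡ 1)) q h) (trans (+-identityʳ _) (cong weight h₀)))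

-- From resolved designs to Kirkman triple systems

Constant : {A : Set} → (Fin 3 → A) → Set
Constant f = f zero ≡ f (suc zero) × f (suc zero) ≡ f (suc (suc zero))

module Assemble {O : Set} {isC : O → Bool}
  (X : Resolved isC (λ x y → x ≢ y × ¬ (isC x ≡ true × isC y ≡ true)))
  {N n : ℕ} (cls : Fin N → O) (pt : Fin n → O) (pt₋ : O → Fin n)
  (cls-injective : ∀ {c c′} → cls c ≡ cls c′ → c ≡ c′) (classOf : ∀ o → isC o ≡ true → ∃[ c ] cls c ≡ o)
  (pt₋∘pt : ∀ x → pt₋ (pt x) ≡ x) (pt∘pt₋ : ∀ o → isC o ≡ false → pt (pt₋ o) ≡ o)
  (isC-cls : ∀ c → isC (cls c) ≡ true) (isC-pt : ∀ x → isC (pt x) ≡ false) where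

  open Cover (covers X) renaming (cover to joinˣ; unique to uniqueˣ)

  at₀ : Block X → Fin N
  at₀ β = proj₁ (classOf (obj X β zero) (kind X β zero))

  at : Block X → Fin 3 → Fin n
  at β i = pt₋ (obj X β (suc i))

  cls-at₀ : ∀ β → cls (at₀ β) ≡ obj X β zero
  cls-at₀ β = proj₂ (classOf (obj X β zero) (kind X β zero))

  pt-at : ∀ β i → pt (at β i) ≡ obj X β (suc i)
  pt-at β i = pt∘pt₋ _ (kind X β (suc i))

  same : ∀ {β β′ i i′} → at β i ≡ at β′ i′ → obj X β (suc i) ≡ obj X β′ (suc i′)
  same {β} {β′} {i} {i′} e = trans (sym (pt-at β i)) (trans (cong pt e) (pt-at β′ i′))

  distinct : ∀ β {i j} → i ≢ j → at β i ≢ at β j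
  distinct β n e = proj₁ (hom {β} (n ∘ suc-injective)) (same {β} {β} e)

  through : ∀ {x y} → x ≢ y → ∃[ β ] ∃[ i ] ∃[ j ] i ≢ j × at β i ≡ x × at β j ≡ y
  through {x} {y} n with joinˣ {pt x} {pt y} ((λ e → n (trans (sym (pt₋∘pt x)) (trans (cong pt₋ e) (pt₋∘pt y)))) , λ (h , _) → clash x h)
    where
    clash : ∀ x → isC (pt x) ≡ true → ⊥
    clash x h with () ← trans (sym (isC-pt x)) h
  ... | β , zero , q , _ , ep , eq with () ← trans (sym (kind X β zero)) (trans (cong isC ep) (isC-pt x))
  ... | β , suc i , zero , _ , ep , eq with () ← trans (sym (kind X β zero)) (trans (cong isC eq) (isC-pt y))
  ... | β , suc i , suc j , n′ , ep , eq =
    β , i , j , n′ ∘ cong suc , trans (cong pt₋ ep) (pt₋∘pt x) , trans (cong pt₋ eq) (pt₋∘pt y)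

  through-unique : ∀ {β β′ i i′ j j′} → i ≢ j → i′ ≢ j′ → at β i ≡ at β′ i′ → at β j ≡ at β′ j′ → β ≡ β′
  through-unique {β} {β′} n n′ ep eq =
    cong proj₁ (uniqueˣ (n ∘ suc-injective) (n′ ∘ suc-injective) (same {β} {β′} ep) (same {β} {β′} eq))

  -- A class and a point are always joined, and by one block only; this is the statement that the
  -- triples of a class partition the points.
  blockAt : ∀ c x → ∃[ β ] ∃[ i ] at₀ β ≡ c × at β i ≡ x
  blockAt c x with joinˣ {cls c} {pt x} ((λ e → clash (trans (sym (isC-cls c)) (trans (cong isC e) (isC-pt x)))) ,
                                         λ (_ , h) → clash (trans (sym h) (isC-pt x)))
    where
    clash : true ≢ false
    clash ()
  ... | β , suc i , q , _ , ep , eq with () ← trans (sym (kind X β (suc i))) (trans (cong isC ep) (isC-cls c))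
  ... | β , zero , zero , _ , ep , eq with () ← trans (sym (kind X β zero)) (trans (cong isC eq) (isC-pt x))
  ... | β , zero , suc i , _ , ep , eq = β , i , cls-injective (trans (cls-at₀ β) ep) , trans (cong pt₋ eq) (pt₋∘pt x)

  blockAt-unique : ∀ {β β′ i i′} → at₀ β ≡ at₀ β′ → at β i ≡ at β′ i′ → (β , i) ≡ (β′ , i′)
  blockAt-unique {β} {β′} {i} {i′} e e′ = tidy (uniqueˣ {β} {zero} {suc i} {β′} {zero} {suc i′} (λ ()) (λ ())
    (trans (sym (cls-at₀ β)) (trans (cong cls e) (cls-at₀ β′))) (same {β} {β′} e′))
    where
    tidy : ∀ {β β′ i i′} → _≡_ {A = Block X × Fin 4 × Fin 4} (β , zero , suc i) (β′ , zero , suc i′) → (β , i) ≡ (β′ , i′)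
    tidy refl = refl

  tri : Block X → Triple n
  tri β = triple (at β zero) (at β (suc zero)) (at β (suc (suc zero)))
                 (distinct β λ ()) (distinct β λ ()) (distinct β λ ())

  on-tri : ∀ β {x} → (x ∈ᵗ tri β) ≡ true → ∃[ i ] at β i ≡ x
  on-tri β {x} h with x ≟ᶠ at β zero | x ≟ᶠ at β (suc zero) | x ≟ᶠ at β (suc (suc zero))
  ... | yes e | _     | _     = zero , sym e
  ... | no _  | yes e | _     = suc zero , sym e
  ... | no _  | no _  | yes e = suc (suc zero) , sym e

  tri-on : ∀ β i → (at β i ∈ᵗ tri β) ≡ true
  tri-on β i with at β i ≟ᶠ at β zero | at β i ≟ᶠ at β (suc zero) | at β i ≟ᶠ at β (suc (suc zero))
  tri-on β i                | yes _ | _     | _     = refl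
  tri-on β i                | no _  | yes _ | _     = refl
  tri-on β i                | no _  | no _  | yes _ = refl
  tri-on β zero             | no n  | no _  | no _  = ⊥-elim (n refl)
  tri-on β (suc zero)       | no _  | no n  | no _  = ⊥-elim (n refl)
  tri-on β (suc (suc zero)) | no _  | no _  | no n  = ⊥-elim (n refl)

  -- A triple is listed at its first point only.
  leads : Fin N → Fin n → Bool
  leads c x = isZero (proj₁ (proj₂ (blockAt c x)))

  triAt : Fin N → Fin n → Triple n
  triAt c x = tri (proj₁ (blockAt c x))

  -- The type of blocks comes without an enumeration. The list is therefore produced from the
  -- points, each of which determines its block in the class, and keeping only leaders removes the
  -- repetitions.
  parallelClass : Fin N → List (Triple n)
  parallelClass c = map (triAt c) (filterᵇ (leads c) (allFin n))

  leader : ∀ {c x} → leads c x ≡ true → at (proj₁ (blockAt c x)) zero ≡ x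
  leader {c} {x} h with blockAt c x
  ... | β , zero , _ , e = e

  blockAt-first : ∀ β → proj₁ (blockAt (at₀ β) (at β zero)) ≡ β × leads (at₀ β) (at β zero) ≡ true
  blockAt-first β = let (_ , _ , e , e′) = blockAt (at₀ β) (at β zero) ; u = blockAt-unique e e′ in
    cong proj₁ u , cong (isZero ∘ proj₂) u

  -- If `β` is the only listed block satisfying `p`, it is counted at its first point and nowhere
  -- else. This serves single points in `isParallel` and pairs in `isSteiner`.
  countClass : ∀ p β → p (tri β) ≡ true → (∀ x → leads (at₀ β) x ≡ true → p (triAt (at₀ β) x) ≡ true → proj₁ (blockAt (at₀ β) x) ≡ β) →
               count p (parallelClass (at₀ β)) ≡ 1
  countClass p β h u = trans (count-map-filter p (triAt (at₀ β)) (leads (at₀ β)) (allFin n))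
    (count-one _ id (at β zero)
      (let (e , l) = blockAt-first β in ∧-intro l (trans (cong (p ∘ tri) e) h))
      (λ x hx → let (l , hp) = ∧-true {leads (at₀ β) x} hx in
        trans (sym (leader {at₀ β} l)) (cong (λ β → at β zero) (u x l hp))))

  isParallel : ∀ c → IsParallelClass n (parallelClass c)
  isParallel c x with blockAt c x
  ... | β , i , refl , refl = countClass (at β i ∈ᵗ_) β (tri-on β i) λ y _ h →
    let (j , e) = on-tri (proj₁ (blockAt (at₀ β) y)) h
    in cong proj₁ (blockAt-unique (proj₁ (proj₂ (proj₂ (blockAt (at₀ β) y)))) e)

  -- The block through two points is unique and belongs to one class, so that class contributes 1
  -- and every other class 0.
  isSteiner : IsSTS n (concat (map parallelClass (allFin N)))
  isSteiner x y n with through n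
  ... | β , i , j , i≢j , refl , refl = count-concat-one both parallelClass id (at₀ β)
      (countClass both β (∧-intro (tri-on β i) (tri-on β j)) (λ z _ → pair (at₀ β) z))
      (λ c c≢ → trans (count-map-filter both (triAt c) (leads c) (allFin _)) (count-zero _ (allFin _) (λ z h →
        c≢ (trans (sym (proj₁ (proj₂ (proj₂ (blockAt c z))))) (cong at₀ (pair c z (proj₂ (∧-true {leads c z} h))))))))
    where
    both : Triple _ → Bool
    both t = (at β i ∈ᵗ t) ∧ (at β j ∈ᵗ t)
    pair : ∀ c z → both (triAt c z) ≡ true → proj₁ (blockAt c z) ≡ β
    pair c z h with ∧-true {at β i ∈ᵗ triAt c z} h
    ... | h₁ , h₂ with on-tri (proj₁ (blockAt c z)) h₁ | on-tri (proj₁ (blockAt c z)) h₂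
    ... | i′ , e₁ | j′ , e₂ = through-unique (λ i′≡j′ → n (trans (sym e₁) (trans (cong (at _) i′≡j′) e₂))) i≢j e₁ e₂

  kts : KTS n
  kts = record
    { classes  = map parallelClass (allFin N)
    ; parallel = All.map⁺ (All.tabulate⁺ isParallel)
    ; steiner  = isSteiner
    }

  -- Wanted for the lower bound: a proper colouring of the listed triples is proper on every block,
  -- in particular on those of an embedded KTS(33).
  tri∈ : ∀ β → tri β ∈ triples kts
  tri∈ β = ∈-concat⁺′ {vs = parallelClass (at₀ β)} inClass (∈-map⁺ parallelClass (∈-allFin (at₀ β)))
    where
    inClass : tri β ∈ parallelClass (at₀ β)
    inClass = let (e , l) = blockAt-first β in
      subst (λ β′ → tri β′ ∈ parallelClass (at₀ β)) e
        (∈-map⁺ (triAt (at₀ β)) (∈-filterᵇ (leads (at₀ β)) (allFin n) (∈-allFin (at β zero)) l))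
      where
      ∈-filterᵇ : ∀ {A : Set} (p : A → Bool) xs {x} → x ∈ xs → p x ≡ true → x ∈ filterᵇ p xs
      ∈-filterᵇ p (x ∷ xs) (here refl) h rewrite h = here refl
      ∈-filterᵇ p (y ∷ xs) (there m) h with p y
      ... | true  = there (∈-filterᵇ p xs m h)
      ... | false = ∈-filterᵇ p xs m h

  triples-tri : ∀ t → t ∈ triples kts → ∃[ β ] t ≡ tri β
  triples-tri t m with ∈-concat⁻′ (map parallelClass (allFin N)) m
  ... | _ , t∈ , c∈ with ∈-map⁻ parallelClass c∈
  ... | c , _ , refl with ∈-map⁻ (triAt c) t∈
  ... | x , _ , e = proj₁ (blockAt c x) , e

  proper : ∀ {δ} {f : Fin n → Fin δ} → (∀ β → ¬ Constant (f ∘ at β)) → IsProperColouring kts δ f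
  proper h t m with triples-tri t m
  ... | β , refl = h β

  proper⁻ : ∀ {δ} {f : Fin n → Fin δ} → IsProperColouring kts δ f → ∀ β → ¬ Constant (f ∘ at β)
  proper⁻ p β = p (tri β) (tri∈ β)

-- Kirkman frames with 3r + 1 holes of size 2

withUnit : {A : Set} {R : Rel A} → Cover (λ _ → R) (λ x y → R x y × Any x y) (λ _ → id)
withUnit = iso id id (λ _ → refl) (λ _ → refl) (_, tt) proj₁

-- A hole of size 6 is three holes of size 2, and `nothing` adjoins a further hole of size 2. With
-- it each large hole has four small ones, which is the shape of AG(2,3) punctured at a point. The
-- puncturing point of the KTS(2u + 1) itself never appears.
kirkman : ∀ r → r % 4 ≤ 1 → Frame {Fin (1 + r * 3)} _≢_
kirkman r h = decompose (iso number unnumber un∘num num∘un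
                  (λ (n , _) e → n (trans (sym (un∘num _)) (trans (cong unnumber e) (un∘num _))))
                  (λ n → n ∘ cong number , tt))
                (λ _ → decompose (fill _≟ᶠ_ Any) parts)
  where
  number : Maybe (Fin r × Fin 3) → Fin (1 + r * 3)
  number nothing  = zero
  number (just x) = suc (uncurry combine x)
  unnumber : Fin (1 + r * 3) → Maybe (Fin r × Fin 3)
  unnumber zero    = nothing
  unnumber (suc x) = just (remQuot 3 x)
  un∘num : ∀ x → unnumber (number x) ≡ x
  un∘num nothing        = refl
  un∘num (just (v , i)) = cong just (remQuot-combine v i)
  num∘un : ∀ x → number (unnumber x) ≡ x
  num∘un zero    = refl
  num∘un (suc x) = cong suc (combine-remQuot {r} 3 x)
  parts : ∀ l → Frame (HoleRel (_≟ᶠ_ {r}) {3} Any l)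
  parts nothing  = uniform₃ r h
  parts (just _) = decompose withUnit (λ _ → K₄)

-- The KTS(33) and its colouring

isClass : Fin 49 → Bool
isClass zero    = false
isClass (suc k) = [ (λ _ → true) , (λ _ → false) ]′ (splitAt 16 {32} k)

-- After the shift by one a code is 16 b + w, where w is a pair in F₄ × F₄. The colour is the second
-- member of the pair and does not depend on b, so the two points of a hole of the original frame
-- follow the same rule.
colour : Fin 49 → Fin 4
colour zero    = zero
colour (suc k) = proj₂ (remQuot {4} 4 (proj₂ (remQuot {3} 16 k)))

Apart : Rel (Fin 49)
Apart p q = ¬ (isClass p ≡ true × isClass q ≡ true)

isClass-combine : ∀ b w → isClass (suc (combine {3} {16} b w)) ≡ isZero b
isClass-combine zero    w rewrite splitAt-↑ˡ 16 w 32 = refl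
isClass-combine (suc b) w rewrite splitAt-↑ʳ 16 32 (combine b w) = refl

apart₃₃ : Fin 49 → Fin 49 → Bool
apart₃₃ p q = not (p == q) ∧ not (isClass p ∧ isClass q)

open Finite 49 apart₃₃ kts33Blocks using () renaming (fobj to obj₃₃)

kts₃₃ : Resolved isClass (λ p q → p ≢ q × Apart p q)
kts₃₃ = resolve (iso id id (λ _ → refl) (λ _ → refl)
    (λ h → let (h₁ , h₂) = ∧-true h in ≢-intro h₁ , λ (e , e′) → not-elim h₂ (∧-intro e e′))
    (λ (n , s) → ∧-intro (≢-elim n) (not-true (λ h → s (∧-true h)))))
  (λ _ _ → refl) (λ _ → Finite.finiteResolved 49 apart₃₃ kts33Blocks isClass refl refl refl)

constant? : ∀ {n} → (Fin 3 → Fin n) → Bool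
constant? f = (f zero == f (suc zero)) ∧ (f (suc zero) == f (suc (suc zero)))

none-constant : ∀ {b n} (f : Fin b → Fin 3 → Fin n) → allF (not ∘ constant? ∘ f) ≡ true → ∀ β → ¬ Constant (f β)
none-constant f h β (e , e′) = not-elim (allF-sound {f = not ∘ constant? ∘ f} h β) (∧-intro (equal e) (equal e′))
  where
  equal : ∀ {n} {i j : Fin n} → i ≡ j → i == j ≡ true
  equal {i = i} refl = ==-refl i

mixed₃₃ : ∀ β → ¬ Constant (colour ∘ obj kts₃₃ β ∘ suc)
mixed₃₃ (tt , β) = none-constant (λ β → colour ∘ obj₃₃ β ∘ suc) refl β

mixed₄ : ∀ a b → ¬ Constant (λ i → TD.f mols4 i a b)
mixed₄ a = none-constant (λ b i → TD.f mols4 i a b) (allF-sound {f = test} refl a)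
  where
  test : Fin 4 → Bool
  test a = allF (λ b → not (constant? (λ i → TD.f mols4 i a b)))

notColourable₃₃ : (g : Fin 49 → Fin 3) → ¬ (∀ β → ¬ Constant (g ∘ obj kts₃₃ β ∘ suc))
notColourable₃₃ g h = notColourable (λ k → g (k mod 49)) (mixed-rows kts33Blocks (λ β → h (tt , β)))
  where
  mixed-rows : ∀ {b} (rows : Vec (Vec ℕ 4) b) → (∀ β → ¬ Constant (λ i → g (lookup (lookup rows β) (suc i) mod 49))) →
               All (Mixed (λ k → g (k mod 49))) (map triplePart (toList rows))
  mixed-rows []                           h = []
  mixed-rows ((_ ∷ _ ∷ _ ∷ _ ∷ []) ∷ rows) h = h zero ∷ mixed-rows rows (h ∘ suc)

-- Numbering of classes and points

module Numbering (c a u : ℕ) where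

  Obj : Set
  Obj = Maybe (Fin u × Fin (c + a))

  isClassObj : Obj → Bool
  isClassObj nothing        = false
  isClassObj (just (_ , k)) = [ (λ _ → true) , (λ _ → false) ]′ (splitAt c k)

  cls : Fin (u * c) → Obj
  cls x = just (proj₁ (remQuot {u} c x) , proj₂ (remQuot {u} c x) ↑ˡ a)

  ptAt : Fin (a * u) ⊎ Fin 1 → Obj
  ptAt (inj₁ x) = just (proj₂ (remQuot {a} u x) , c ↑ʳ proj₁ (remQuot {a} u x))
  ptAt (inj₂ _) = nothing

  pt : Fin (a * u + 1) → Obj
  pt x = ptAt (splitAt (a * u) x)

  ∞ : Fin (a * u + 1)
  ∞ = (a * u) ↑ʳ zero

  -- The position `q` inside a hole is the major index: points with equal `q` form a run of length
  -- `u`, on which the colour will be constant, so colour classes are counted by runs.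
  point : Fin u → Fin a → Fin (a * u + 1)
  point v q = combine q v ↑ˡ 1

  pt₋ : Obj → Fin (a * u + 1)
  pt₋ nothing        = ∞
  -- On classes ∞ is only a default value; `pt∘pt₋` is restricted to points.
  pt₋ (just (v , k)) = [ (λ _ → ∞) , point v ]′ (splitAt c {a} k)

  cls-injective : ∀ {x y} → cls x ≡ cls y → x ≡ y
  cls-injective {x} {y} e = trans (sym (combine-remQuot {u} c x)) (trans (cong₂ combine (fsts e) (↑ˡ-injective a _ _ (snds e))) (combine-remQuot {u} c y))
    where
    fsts : ∀ {x y : Fin u} {k k′ : Fin (c + a)} → _≡_ {A = Obj} (just (x , k)) (just (y , k′)) → x ≡ y
    fsts refl = refl
    snds : ∀ {x y : Fin u} {k k′ : Fin (c + a)} → _≡_ {A = Obj} (just (x , k)) (just (y , k′)) → k ≡ k′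
    snds refl = refl

  classOf : ∀ o → isClassObj o ≡ true → ∃[ x ] cls x ≡ o
  classOf (just (v , k)) h with splitAt c {a} k in eq
  ... | inj₁ w = combine v w , trans (cong (λ (v , w) → just (v , w ↑ˡ a)) (remQuot-combine v w))
                                     (cong (λ k → just (v , k)) (splitAt⁻¹-↑ˡ {c} {a} eq))

  pt₋∘pt : ∀ x → pt₋ (pt x) ≡ x
  pt₋∘pt x with splitAt (a * u) x in eq
  ... | inj₁ y rewrite splitAt-↑ʳ c a (proj₁ (remQuot {a} u y)) =
    trans (cong (_↑ˡ 1) (combine-remQuot {a} u y)) (splitAt⁻¹-↑ˡ {a * u} {1} eq)
  ... | inj₂ zero = splitAt⁻¹-↑ʳ {a * u} {1} eq

  pt-point : ∀ v q → pt (point v q) ≡ just (v , c ↑ʳ q)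
  pt-point v q = trans (cong ptAt (splitAt-↑ˡ (a * u) (combine q v) 1))
                       (cong (λ (q , v) → just (v , c ↑ʳ q)) (remQuot-combine q v))

  pt-∞ : pt ∞ ≡ nothing
  pt-∞ = cong ptAt (splitAt-↑ʳ (a * u) 1 zero)

  pt∘pt₋ : ∀ o → isClassObj o ≡ false → pt (pt₋ o) ≡ o
  pt∘pt₋ nothing h = pt-∞
  pt∘pt₋ (just (v , k)) h with splitAt c {a} k in eq
  ... | inj₂ q = trans (pt-point v q) (cong (λ k → just (v , k)) (splitAt⁻¹-↑ʳ {c} {a} eq))

  isClass-cls : ∀ x → isClassObj (cls x) ≡ true
  isClass-cls x rewrite splitAt-↑ˡ c (proj₂ (remQuot {u} c x)) a = refl

  isClass-pt : ∀ x → isClassObj (pt x) ≡ false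
  isClass-pt x with splitAt (a * u) x
  ... | inj₂ _ = refl
  ... | inj₁ y rewrite splitAt-↑ʳ c a (proj₁ (remQuot {a} u y)) = refl

-- The KTS(32u + 1), its colouring and its chromatic number

module Construction
  (S : Resolved isClass (λ p q → p ≢ q × Apart p q)) (mixedS : ∀ β → ¬ Constant (colour ∘ obj S β ∘ suc))
  (notColourableS : (g : Fin 49 → Fin 3) → ¬ (∀ β → ¬ Constant (g ∘ obj S β ∘ suc)))
  (D : TD 3 4) (mixedD : ∀ a b → ¬ Constant (λ i → TD.f D i a b))
  (u : ℕ) (K : Frame {Fin u} _≢_) where

  open Numbering 16 32 u

  -- The position of an object in the KTS(33) of its own hole. As ∞ has position `zero` in all of
  -- them, kinds and colours of objects can be defined through positions.
  local : Obj → Fin 49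
  local = code (_≟ᶠ_ {u}) Apart

  inflated : Frame {Fin u × Fin 16} (_≢_ ⊗ Any)
  inflated = inflate (productTD D D) K

  big : Resolved {Fin u × Fin 48} (isClass ∘ suc ∘ proj₂)
          (λ x y → proj₁ x ≢ proj₁ y × Apart (suc (proj₂ x)) (suc (proj₂ y)))
  big = resolve {isC′ = λ _ → isZero ∘ proj₂} (iso pack unpack unpack∘pack pack∘unpack to from)
          (λ _ ((v , w) , b) → isClass-combine b w) (λ _ → inflated)
    where
    pack : (Fin u × Fin 16) × Fin 3 → Fin u × Fin 48
    pack ((v , w) , b) = v , combine b w
    unpack : Fin u × Fin 48 → (Fin u × Fin 16) × Fin 3
    unpack (v , k) = (v , proj₂ (remQuot {3} 16 k)) , proj₁ (remQuot {3} 16 k)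
    unpack∘pack : ∀ x → unpack (pack x) ≡ x
    unpack∘pack ((v , w) , b) = cong (λ (b , w) → (v , w) , b) (remQuot-combine b w)
    pack∘unpack : ∀ x → pack (unpack x) ≡ x
    pack∘unpack (v , k) = cong (v ,_) (combine-remQuot {3} 16 k)
    to : ∀ {x y} → ((_≢_ ⊗ Any) ⊗ _∥_) x y → proj₁ (pack x) ≢ proj₁ (pack y) × Apart (suc (proj₂ (pack x))) (suc (proj₂ (pack y)))
    to {(v , w) , b} {(v′ , w′) , b′} ((n , _) , s) =
      n , λ (h , h′) → s (trans (sym (isClass-combine b w)) h , trans (sym (isClass-combine b′ w′)) h′)
    from : ∀ {x y} → proj₁ (pack x) ≢ proj₁ (pack y) × Apart (suc (proj₂ (pack x))) (suc (proj₂ (pack y))) → ((_≢_ ⊗ Any) ⊗ _∥_) x y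
    from {(v , w) , b} {(v′ , w′) , b′} (n , s) =
      (n , tt) , λ (h , h′) → s (trans (isClass-combine b w) h , trans (isClass-combine b′ w′) h′)

  isClassIn : ∀ l → Hole (_≟ᶠ_ {u}) Apart l → Bool
  isClassIn nothing  = isClass ∘ suc ∘ proj₂
  isClassIn (just _) = isClass

  parts : ∀ l → Resolved (isClassIn l) (HoleRel (_≟ᶠ_ {u}) Apart l)
  parts nothing  = big
  parts (just _) = S

  place : ∀ l → Hole (_≟ᶠ_ {u}) Apart l → Obj
  place = embed (_≟ᶠ_ {u}) Apart

  isClass-place : ∀ l p → isClass (local (place l p)) ≡ isClassIn l p
  isClass-place nothing  p       = refl
  isClass-place (just _) zero    = refl
  isClass-place (just _) (suc _) = refl

  system : Resolved (isClass ∘ local) (λ x y → x ≢ y × Apart (local x) (local y))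
  system = resolve (fill _≟ᶠ_ Apart) isClass-place parts

  isClass-local : ∀ o → isClass (local o) ≡ isClassObj o
  isClass-local nothing  = refl
  isClass-local (just _) = refl

  open Assemble system cls pt pt₋ cls-injective (λ o h → classOf o (trans (sym (isClass-local o)) h))
    pt₋∘pt (λ o h → pt∘pt₋ o (trans (sym (isClass-local o)) h))
    (λ c → trans (isClass-local (cls c)) (isClass-cls c)) (λ x → trans (isClass-local (pt x)) (isClass-pt x)) public

  col : Fin (32 * u + 1) → Fin 4
  col = colour ∘ local ∘ pt

  -- A block inside a filled hole is a block of `S`. The points of a block across holes have
  -- inflation coordinates `f i a b` in the product design, and their colours are the values of `D`
  -- at the second components of `a` and `b`, where `mixedD` applies.
  mixed : ∀ β → ¬ Constant (col ∘ at β)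
  mixed β = mixedObj β ∘ constant-cong (λ i → cong (colour ∘ local) (pt-at β i))
    where
    constant-cong : {A : Set} {f g : Fin 3 → A} → (∀ i → f i ≡ g i) → Constant f → Constant g
    constant-cong h (e , e′) = trans (sym (h _)) (trans e (h _)) , trans (sym (h _)) (trans e′ (h _))
    colour-pack : ∀ b w → colour (suc (combine {3} {16} b w)) ≡ proj₂ (remQuot {4} 4 w)
    colour-pack b w = cong (λ (_ , w) → proj₂ (remQuot {4} 4 w)) (remQuot-combine b w)
    local-place : ∀ v p → local (place (just v) p) ≡ p
    local-place v zero    = refl
    local-place v (suc _) = refl
    mixedObj : ∀ β → ¬ Constant (λ i → colour (local (obj system β (suc i))))
    mixedObj (just v , β) = mixedS β ∘ constant-cong (λ i → cong colour (local-place v (obj S β (suc i))))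
    mixedObj (nothing , _ , _ , β , (a , b)) =
      mixedD (proj₂ (remQuot {4} 4 a)) (proj₂ (remQuot {4} 4 b)) ∘ constant-cong inflatedColour
      where
      inflatedColour : ∀ i → colour (suc (combine (proj₂ (obj K β (suc i))) (TD.f (productTD D D) i a b)))
                           ≡ TD.f D i (proj₂ (remQuot {4} 4 a)) (proj₂ (remQuot {4} 4 b))
      inflatedColour i = trans (colour-pack (proj₂ (obj K β (suc i))) _)
        (cong proj₂ (remQuot-combine {4} {4} (TD.f D i (proj₁ (remQuot {4} 4 a)) (proj₁ (remQuot {4} 4 b)))
                                             (TD.f D i (proj₂ (remQuot {4} 4 a)) (proj₂ (remQuot {4} 4 b)))))

  -- Each colour occurs at 8 of the 32 positions of a hole other than ∞, and ∞ adds one to colour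
  -- `zero`. The sizes can thus differ by 1 at most.
  classSize≡ : ∀ i → classSize col i ≡ 8 * u + weight ⌊ zero ≟ᶠ i ⌋
  classSize≡ i = trans (count-tabulate (λ x → ⌊ col x ≟ᶠ i ⌋) id)
    (trans (countF-*+1 32 u (λ x → ⌊ col x ≟ᶠ i ⌋) (level i) ⌊ zero ≟ᶠ i ⌋
              (λ q v → cong (λ o → ⌊ colour (local o) ≟ᶠ i ⌋) (pt-point v q))
              (cong (λ o → ⌊ colour (local o) ≟ᶠ i ⌋) pt-∞))
           (cong (λ k → k * u + weight ⌊ zero ≟ᶠ i ⌋) (levels i)))
    where
    level : Fin 4 → Fin 32 → Bool
    level i q = ⌊ colour (suc (16 ↑ʳ q)) ≟ᶠ i ⌋
    levels : ∀ i → countF (level i) ≡ 8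
    levels zero                   = refl
    levels (suc zero)             = refl
    levels (suc (suc zero))       = refl
    levels (suc (suc (suc zero))) = refl

  equitable : IsEquitable col
  equitable i j = subst₂ (λ m n → m ≤ n + 1) (sym (classSize≡ i)) (sym (classSize≡ j))
    (≤-trans (+-monoʳ-≤ (8 * u) (weight≤1 ⌊ zero ≟ᶠ i ⌋)) (+-monoˡ-≤ 1 (m≤m+n (8 * u) _)))
    where
    weight≤1 : ∀ b → weight b ≤ 1
    weight≤1 true  = s≤s z≤n
    weight≤1 false = z≤n

  -- The argument `v` names a hole. Its blocks form a copy of `S` in the system, and fewer than four
  -- colours embed into three, so a colouring would restrict to a 3-colouring of `S`.
  notColourableBelow4 : Fin u → ∀ δ → δ < 4 → ¬ Colourable kts δ
  notColourableBelow4 v δ δ<4 (f , p) = notColourableS (λ k → inject≤ (f (pt₋ (place (just v) k))) (≤-pred δ<4))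
    (λ β (e , e′) → proper⁻ p (just v , β) (inject≤-injective _ _ _ _ e , inject≤-injective _ _ _ _ e′))

  result : Fin u → Σ (KTS (32 * u + 1)) λ K → HasChromaticNumber K 4 ×
           Σ (Fin (32 * u + 1) → Fin 4) λ col → IsProperColouring K 4 col × IsEquitable col
  result v = kts , ((col , proper mixed) , notColourableBelow4 v) , col , proper mixed , equitable

theorem4p5 : ∀ (u : ℕ) → u > 0 → (u % 12 ≡ 1 ⊎ u % 12 ≡ 4) →
    Σ (KTS (32 * u + 1)) λ K →
    HasChromaticNumber K 4 ×
    Σ (Fin (32 * u + 1) → Fin 4) λ col → IsProperColouring K 4 col × IsEquitable col
theorem4p5 u u>0 h = Construction.result kts₃₃ mixed₃₃ notColourable₃₃ mols4 mixed₄ u K (first u>0)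
  where
  order : ∃[ r ] r % 4 ≤ 1 × 1 + r * 3 ≡ u
  -- Here 12 k + 1 = 1 + 3 · 4 k and 12 k + 4 = 1 + 3 (4 k + 1), with k = u / 12.
  order = [ (λ e → u / 12 * 4 , residue 0 (u / 12) z≤n , trans (regroup (u / 12)) (division e))
          , (λ e → 1 + u / 12 * 4 , residue 1 (u / 12) (s≤s z≤n) , trans (cong (3 +_) (regroup (u / 12))) (division e)) ]′ h
    where
    residue : ∀ e k → e ≤ 1 → (e + k * 4) % 4 ≤ 1
    residue 0 k _ = ≤-trans (≤-reflexive ([m+kn]%n≡m%n 0 k 4)) z≤n
    residue 1 k _ = ≤-reflexive ([m+kn]%n≡m%n 1 k 4)
    residue (suc (suc _)) k (s≤s ())
    regroup : ∀ k → 1 + k * 4 * 3 ≡ 1 + k * 12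
    regroup = solve-∀
    division : ∀ {e} → u % 12 ≡ e → e + u / 12 * 12 ≡ u
    division refl = sym (m≡m%n+[m/n]*n u 12)
  first : ∀ {u} → u > 0 → Fin u
  first {suc _} _ = zero
  K : Frame {Fin u} _≢_
  K = subst (λ n → Frame {Fin n} _≢_) (proj₂ (proj₂ order)) (kirkman (proj₁ order) (proj₁ (proj₂ order)))
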